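{- Let $\mathsf{cIAF}=(A,\varphi)$ be a constrained incomplete argumentation framework, let $a\in A$ be such that $\models\varphi\to\mathtt{aw}_a$ (i.e. the formula is valid), and let $\sigma\in\{st,co,gr,pr,se,id,ea,na,stg\}$. Then: (1) the answer to $\sigma$-NSA with input $\mathsf{cIAF}$ and $a$ is yes iff $v_{\mathsf{cIAF}}\models[\mathsf{makeComp}^{\mathsf{cIAF}};\mathsf{makeExt}^\sigma]\mathtt{in}_a$; (2) the answer to $\sigma$-NCA with input $\mathsf{cIAF}$ and $a$ is yes iff $v_{\mathsf{cIAF}}\models[\mathsf{makeComp}^{\mathsf{cIAF}}]\langle\mathsf{makeExt}^\sigma\rangle\mathtt{in}_a$; (3) the answer to $\sigma$-PCA with input $\mathsf{cIAF}$ and $a$ is yes iff $v_{\mathsf{cIAF}}\models\langle\mathsf{makeComp}^{\mathsf{cIAF}};\mathsf{makeExt}^\sigma\rangle\mathtt{in}_a$; (4) the answer to $\sigma$-PSA with input $\mathsf{cIAF}$ and $a$ is yes iff $v_{\mathsf{cIAF}}\models\langle\mathsf{makeComp}^{\mathsf{cIAF}}\rangle[\mathsf{makeExt}^\sigma]\mathtt{in}_a$.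
   Context: **Argumentation.** Fix a finite non-empty set $\mathcal U$ of arguments. An argumentation framework (AF) is a pair $(A,R)$ with $A\subseteq\mathcal U$, $R\subseteq A\times A$. For $E\subseteq A$: $E^+=\{x\in A\mid\exists y\in E:(y,x)\in R\}$, $E^\oplus=E\cup E^+$ (range). $E$ is conflict-free iff $E\cap E^+=\emptyset$; $E$ defends $a\in A$ iff every $x\in A$ with $(x,a)\in R$ is in $E^+$; $E$ is admissible iff it is conflict-free and defends all its members. $\sigma(A,R)$ denotes the set of $\sigma$-extensions of $(A,R)$, where $E\subseteq A$ is: stable ($st$) iff conflict-free and $A\setminus E\subseteq E^+$; complete ($co$) iff conflict-free and $E$ contains precisely the arguments of $A$ it defends; grounded ($gr$) iff a $\subseteq$-minimal complete extension; preferred ($pr$) iff a $\subseteq$-maximal complete extension; semi-stable ($se$) iff complete and there is no complete $E'$ with $E^\oplus\subset E'^\oplus$ (strict); ideal ($id$) iff the $\subseteq$-maximal ideal set, an ideal set being an admissible set contained in every preferred extension; eager ($ea$) iff the $\subseteq$-maximal eager set, an eager set being an admissible set contained in every semi-stable extension; naive ($na$) iff a $\subseteq$-maximal conflict-free set; stage ($stg$) iff conflict-free with $\subseteq$-maximal range among conflict-free sets. **DL-PA.** $\mathtt{Prp}$ is a countably infinite set of propositional variables containing the pairwise distinct variables $\mathtt{aw}_x$, $\mathtt{in}_x$ ($x\in\mathcal U$), $\mathtt r_{x,y}$ ($x,y\in\mathcal U$), and further fresh variables $\mathtt{in}'_x$ ($x\in\mathcal U$). For $A\subseteq\mathcal U$,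 $R\subseteq\mathcal U\times\mathcal U$ let $\mathsf{IN}_A=\{\mathtt{in}_x\mid x\in A\}$, $\mathsf{AW}_A=\{\mathtt{aw}_x\mid x\in A\}$, $\mathsf{ATT}_R=\{\mathtt r_{x,y}\mid(x,y)\in R\}$, $\mathtt{Prp}_A=\mathsf{AW}_A\cup\mathsf{IN}_A\cup\mathsf{ATT}_{A\times A}$. Formulas and programs: $\varphi::=p\mid\neg\varphi\mid(\varphi\wedge\varphi)\mid[\pi]\varphi$ and $\pi::=+p\mid -p\mid\varphi?\mid(\pi;\pi)\mid(\pi\cup\pi)\mid\pi^{ -1}$, $p\in\mathtt{Prp}$. Valuations are subsets $v\subseteq\mathtt{Prp}$; $v\models p$ iff $p\in v$; Booleans as usual; $v\models[\pi]\varphi$ iff $v'\models\varphi$ for all $v'$ with $(v,v')\in||\pi||$; $\langle\pi\rangle\varphi=\neg[\pi]\neg\varphi$. Programs are interpreted by $||+p||=\{(v,v\cup\{p\})\}$, $||-p||=\{(v,v\setminus\{p\})\}$, $||\varphi?||=\{(v,v)\mid v\models\varphi\}$, $;$ is relation composition, $\cup$ is union, $\pi^{ -1}$ is the inverse relation. $\mathsf{skip}=\top?$. For finite $P=\{p_1,\dots,p_n\}\subseteq\mathtt{Prp}$: $\mathsf{mkTrueOne}(P)=\bigcup_{p\in P}(\neg p?;+p)$, $\mathsf{mkFalseOne}(P)=\bigcup_{p\in P}(p?;-p)$, $\mathsf{mkTrueSome}(P)=(+p_1\cup\mathsf{skip});\dots;(+p_n\cup\mathsf{skip})$, $\mathsf{mkFalseSome}(P)=(-p_1\cup\mathsf{skip});\dots;(-p_n\cup\mathsf{skip})$,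 $\mathsf{vary}(P)=(+p_1\cup -p_1);\dots;(+p_n\cup -p_n)$ (empty sequences and unions are $\mathsf{skip}$). For a valuation $v$: $A_v=\{x\in\mathcal U\mid\mathtt{aw}_x\in v\}$, $R_v=\{(x,y)\in A_v\times A_v\mid\mathtt r_{x,y}\in v\}$. **Extension programs.** For each $\sigma$, $\mathsf{makeExt}^\sigma=\mathsf{vary}(\mathsf{IN}_{\mathcal U});\varphi_\sigma?$, where $\varphi_{st}=\mathsf{Stable}$, $\varphi_{co}=\mathsf{Complete}$, $\varphi_{gr}=\mathsf{Grounded}$, $\varphi_{pr}=\mathsf{Preferred}$, $\varphi_{na}=\mathsf{Naive}$, $\varphi_{se}=\mathsf{SemiStable}$, $\varphi_{stg}=\mathsf{Stage}$, $\varphi_{id}=\mathsf{Ideal}$, $\varphi_{ea}=\mathsf{Eager}$ are the following (all indices range over $\mathcal U$): $\mathsf{Well}=\bigwedge_x(\mathtt{in}_x\to\mathtt{aw}_x)$; $\mathsf{ConFree}=\mathsf{Well}\wedge\bigwedge_x\bigwedge_y\neg(\mathtt{in}_x\wedge\mathtt{in}_y\wedge\mathtt r_{x,y})$; $\mathsf{Admissible}=\mathsf{ConFree}\wedge\bigwedge_x(\mathtt{in}_x\to\bigwedge_y((\mathtt{aw}_y\wedge\mathtt r_{y,x})\to\bigvee_z(\mathtt{in}_z\wedge\mathtt r_{z,y})))$; $\mathsf{copy}(\mathsf{IN}_{\mathcal U})$ = sequential composition over $x\in\mathcal U$ of $(\mathtt{in}_x?;+\mathtt{in}'_x)\cup(\neg\mathtt{in}_x?;-\mathtt{in}'_x)$;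 $\mathsf{Rg}_x=\mathtt{in}_x\vee(\mathtt{aw}_x\wedge\bigvee_y(\mathtt{in}_y\wedge\mathtt r_{y,x}))$, $\mathsf{Rg}'_x=\mathtt{in}'_x\vee(\mathtt{aw}_x\wedge\bigvee_y(\mathtt{in}'_y\wedge\mathtt r_{y,x}))$, $\mathsf{IncludedInCp}=\bigwedge_x(\mathsf{Rg}_x\to\mathsf{Rg}'_x)$, $\mathsf{IncludesCp}=\bigwedge_x(\mathsf{Rg}'_x\to\mathsf{Rg}_x)$; $\mathsf{Stable}=\mathsf{Well}\wedge\bigwedge_x(\mathtt{aw}_x\to(\mathtt{in}_x\leftrightarrow\neg\bigvee_y(\mathtt{in}_y\wedge\mathtt r_{y,x})))$; $\mathsf{Complete}=\mathsf{ConFree}\wedge\bigwedge_x(\mathtt{in}_x\leftrightarrow\bigwedge_y((\mathtt{aw}_y\wedge\mathtt r_{y,x})\to\bigvee_z(\mathtt{in}_z\wedge\mathtt r_{z,y})))$; $\mathsf{Grounded}=\mathsf{Complete}\wedge[\mathsf{mkFalseOne}(\mathsf{IN}_{\mathcal U});\mathsf{mkFalseSome}(\mathsf{IN}_{\mathcal U})]\neg\mathsf{Complete}$; $\mathsf{Preferred}=\mathsf{Admissible}\wedge[\mathsf{mkTrueOne}(\mathsf{IN}_{\mathcal U});\mathsf{mkTrueSome}(\mathsf{IN}_{\mathcal U})]\neg\mathsf{Admissible}$; $\mathsf{Naive}=\mathsf{ConFree}\wedge[\mathsf{mkTrueOne}(\mathsf{IN}_{\mathcal U})]\neg\mathsf{ConFree}$;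 $\mathsf{SemiStable}=\mathsf{Complete}\wedge[\mathsf{copy}(\mathsf{IN}_{\mathcal U});\mathsf{makeExt}^{co}](\mathsf{IncludesCp}\to\mathsf{IncludedInCp})$; $\mathsf{Stage}=\mathsf{ConFree}\wedge[\mathsf{copy}(\mathsf{IN}_{\mathcal U});\mathsf{vary}(\mathsf{IN}_{\mathcal U});\mathsf{ConFree}?](\mathsf{IncludesCp}\to\mathsf{IncludedInCp})$; $\mathsf{IdealSet}=\mathsf{Admissible}\wedge\bigwedge_x(\mathtt{in}_x\to[\mathsf{makeExt}^{pr}]\mathtt{in}_x)$, $\mathsf{EagerSet}=\mathsf{Admissible}\wedge\bigwedge_x(\mathtt{in}_x\to[\mathsf{makeExt}^{se}]\mathtt{in}_x)$; $\mathsf{Ideal}=\mathsf{IdealSet}\wedge[\mathsf{mkTrueOne}(\mathsf{IN}_{\mathcal U});\mathsf{mkTrueSome}(\mathsf{IN}_{\mathcal U})]\neg\mathsf{IdealSet}$; $\mathsf{Eager}=\mathsf{EagerSet}\wedge[\mathsf{mkTrueOne}(\mathsf{IN}_{\mathcal U});\mathsf{mkTrueSome}(\mathsf{IN}_{\mathcal U})]\neg\mathsf{EagerSet}$. **Constrained incomplete AFs.** A constrained incomplete AF (cIAF) is a pair $(A,\varphi)$ with $A\subseteq\mathcal U$ and $\varphi$ a Boolean formula over $\mathsf{AW}_A\cup\mathsf{ATT}_{A\times A}$. Its set of completions is $\{(A_v,R_v)\mid v\subseteq\mathtt{Prp}_A,\ v\models\varphi\}$. Decision problems for input a cIAF $(A,\varphi)$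 and $a\in A$ with $\models\varphi\to\mathtt{aw}_a$: $\sigma$-NSA (necessary sceptical acceptance): for every completion $(A^*,R^*)$ and every $E\in\sigma(A^*,R^*)$, $a\in E$? $\sigma$-NCA (necessary credulous): for every completion there is $E\in\sigma(A^*,R^*)$ with $a\in E$? $\sigma$-PCA (possible credulous): is there a completion and an $E\in\sigma(A^*,R^*)$ with $a\in E$? $\sigma$-PSA (possible sceptical): is there a completion such that $a\in E$ for every $E\in\sigma(A^*,R^*)$? **Encoding of cIAFs.** $v_{\mathsf{cIAF}}=\emptyset$ and $\mathsf{makeComp}^{\mathsf{cIAF}}=\mathsf{vary}(\mathsf{AW}_A);\mathsf{vary}(\mathsf{ATT}_{A\times A});\varphi?$.
   Formalization: In Complete the conjunct for x is guarded as aw_x → (in_x ↔ …); without the guard an unattacked x outside A_v forces in_x against Well, so Complete is unsatisfiable and the claim fails (e.g. U={0,1}, A={0}, φ=aw_0, σ=co, part 3). This also affects gr, se, ea. -}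

module Defs where

open import Data.Bool.Base as Bool using (Bool; true; false)
open import Data.Fin.Base using (Fin)
open import Data.Fin.Subset as Subset using (Subset)
open import Data.Fin.Subset.Properties using (_∈?_)
open import Data.List.Base
  using (List; []; _∷_; _++_; map; filter; allFin; cartesianProductWith)
open import Data.List.Membership.Propositional using () renaming (_∈_ to _∈ˡ_)
open import Data.Nat.Base using (ℕ)
open import Data.Product using (_×_; _,_; proj₁; proj₂; ∃-syntax)
open import Data.Sum.Base using (_⊎_)
open import Data.Vec.Base using (Vec; lookup; tabulate)
open import Data.Vec.Properties using (lookup∘tabulate; lookup⇒[]=; []=⇒lookup)
open import Level using (0ℓ)
open import Relation.Binary.Core using (Rel)
open import Relation.Binary.PropositionalEquality using (_≡_; refl; sym; trans; subst)
open import Relation.Nullary.Negation using (¬_)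
open import Relation.Unary as U using (Pred)

private
  variable
    n : ℕ

-- The universe of arguments is Fin n.  The attack relation is stored as its table of successor sets:
-- (x , y) ∈ R iff y belongs to the x-th entry.  The last field is
-- irrelevant, so _≡_ on AF is equality of the pairs (A , R).
record AF (n : ℕ) : Set where
  constructor af
  field
    args     : Subset n
    attacks  : Vec (Subset n) n
    .attacks-on-args : ∀ {x y} → y Subset.∈ lookup attacks x →
                       x Subset.∈ args × y Subset.∈ args

open AF public

Attacks : AF n → Fin n → Fin n → Set
Attacks F x y = y Subset.∈ lookup (attacks F) x

⟪_⟫ : Subset n → Pred (Fin n) 0ℓ
⟪ E ⟫ x = x Subset.∈ E

_⁺[_] : Subset n → AF n → Pred (Fin n) 0ℓ
(E ⁺[ F ]) x = x Subset.∈ args F × ∃[ y ] (y Subset.∈ E × Attacks F y x)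

_⊕[_] : Subset n → AF n → Pred (Fin n) 0ℓ
E ⊕[ F ] = ⟪ E ⟫ U.∪ (E ⁺[ F ])

Defends : AF n → Subset n → Pred (Fin n) 0ℓ
Defends F E a = ∀ x → x Subset.∈ args F → Attacks F x a → (E ⁺[ F ]) x

Maximal : Pred (Subset n) 0ℓ → Pred (Subset n) 0ℓ
Maximal P E = P E × ¬ (∃[ E′ ] (P E′ × E Subset.⊂ E′))

Minimal : Pred (Subset n) 0ℓ → Pred (Subset n) 0ℓ
Minimal P E = P E × ¬ (∃[ E′ ] (P E′ × E′ Subset.⊂ E))

RangeMaximal : AF n → Pred (Subset n) 0ℓ → Pred (Subset n) 0ℓ
RangeMaximal F P E = P E × ¬ (∃[ E′ ] (P E′ × (E ⊕[ F ]) U.⊂ (E′ ⊕[ F ])))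

-- The standing requirement E ⊆ A is included here, hence in every
-- notion below.
ConflictFree : AF n → Pred (Subset n) 0ℓ
ConflictFree F E = E Subset.⊆ args F × U.Empty (⟪ E ⟫ U.∩ (E ⁺[ F ]))

AdmissibleSet : AF n → Pred (Subset n) 0ℓ
AdmissibleSet F E = ConflictFree F E × ⟪ E ⟫ U.⊆ Defends F E

StableExt CompleteExt GroundedExt PreferredExt SemiStableExt : AF n → Pred (Subset n) 0ℓ
StableExt     F E = ConflictFree F E × (⟪ args F ⟫ U.∖ ⟪ E ⟫) U.⊆ (E ⁺[ F ])
CompleteExt   F E = ConflictFree F E × ⟪ E ⟫ U.≐ (⟪ args F ⟫ U.∩ Defends F E)
GroundedExt   F   = Minimal (CompleteExt F)
PreferredExt  F   = Maximal (CompleteExt F)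
SemiStableExt F   = RangeMaximal F (CompleteExt F)

IsIdealSet IsEagerSet : AF n → Pred (Subset n) 0ℓ
IsIdealSet F E = AdmissibleSet F E × (∀ E′ → PreferredExt F E′ → E Subset.⊆ E′)
IsEagerSet F E = AdmissibleSet F E × (∀ E′ → SemiStableExt F E′ → E Subset.⊆ E′)

IdealExt EagerExt NaiveExt StageExt : AF n → Pred (Subset n) 0ℓ
IdealExt F = Maximal (IsIdealSet F)
EagerExt F = Maximal (IsEagerSet F)
NaiveExt F = Maximal (ConflictFree F)
StageExt F = RangeMaximal F (ConflictFree F)

data Semantics : Set where
  st co gr pr se id ea na stg : Semantics

Extension : Semantics → AF n → Pred (Subset n) 0ℓ
Extension st  = StableExt
Extension co  = CompleteExt
Extension gr  = GroundedExt
Extension pr  = PreferredExt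
Extension se  = SemiStableExt
Extension id  = IdealExt
Extension ea  = EagerExt
Extension na  = NaiveExt
Extension stg = StageExt

-- Up to renaming, any countably infinite set of variables containing the
-- finitely many named ones; in′ is the fresh copy of in°.
data Prp (n : ℕ) : Set where
  aw    : Fin n → Prp n
  in°   : Fin n → Prp n
  in′   : Fin n → Prp n
  r     : Fin n → Fin n → Prp n
  other : ℕ → Prp n

infix  9 [_]_ ⟨_⟩_ ∼_
infix  8 _⁻¹
infixr 7 _∧_
infixr 6 _∨_
infixr 5 _⇒_ _⇔_
infixr 4 _⨾_
infixr 3 _∪_

mutual
  data Formula (n : ℕ) : Set where
    var  : Prp n → Formula n
    ∼_   : Formula n → Formula n
    _∧_  : Formula n → Formula n → Formula n
    [_]_ : Program n → Formula n → Formula n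

  data Program (n : ℕ) : Set where
    +_   : Prp n → Program n
    -_   : Prp n → Program n
    test : Formula n → Program n
    _⨾_  : Program n → Program n → Program n
    _∪_  : Program n → Program n → Program n
    _⁻¹  : Program n → Program n

-- Decidable subsets of Prp, compared extensionally through ⟦_⟧ᵛ and U._≐_.
Valuation : ℕ → Set
Valuation n = Prp n → Bool

⟦_⟧ᵛ : Valuation n → Pred (Prp n) 0ℓ
⟦ v ⟧ᵛ p = v p ≡ true

∅ᵛ : Valuation n
∅ᵛ _ = false

infix 4 _⊨_ ⊨_

mutual
  _⊨_ : Valuation n → Formula n → Set
  v ⊨ var p     = p U.∈ ⟦ v ⟧ᵛ
  v ⊨ ∼ φ       = ¬ (v ⊨ φ)
  v ⊨ φ ∧ ψ     = (v ⊨ φ) × (v ⊨ ψ)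
  v ⊨ [ π ] φ   = ∀ v′ → ∥ π ∥ v v′ → v′ ⊨ φ

  ∥_∥ : Program n → Rel (Valuation n) 0ℓ
  ∥ + p ∥    v v′ = ⟦ v′ ⟧ᵛ U.≐ (⟦ v ⟧ᵛ U.∪ U.｛ p ｝)
  ∥ - p ∥    v v′ = ⟦ v′ ⟧ᵛ U.≐ (⟦ v ⟧ᵛ U.∖ U.｛ p ｝)
  ∥ test φ ∥ v v′ = ⟦ v′ ⟧ᵛ U.≐ ⟦ v ⟧ᵛ × (v ⊨ φ)
  ∥ π ⨾ ρ ∥  v v′ = ∃[ u ] (∥ π ∥ v u × ∥ ρ ∥ u v′)
  ∥ π ∪ ρ ∥  v v′ = ∥ π ∥ v v′ ⊎ ∥ ρ ∥ v v′
  ∥ π ⁻¹ ∥   v v′ = ∥ π ∥ v′ v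

⊨_ : Formula n → Set
⊨ φ = ∀ v → v ⊨ φ

_∨_ _⇒_ _⇔_ : Formula n → Formula n → Formula n
φ ∨ ψ = ∼ (∼ φ ∧ ∼ ψ)
φ ⇒ ψ = ∼ (φ ∧ ∼ ψ)
φ ⇔ ψ = (φ ⇒ ψ) ∧ (ψ ⇒ φ)

⊤ ⊥ : Formula n
⊤ = var (other 0) ∨ ∼ var (other 0)
⊥ = ∼ ⊤

⟨_⟩_ : Program n → Formula n → Formula n
⟨ π ⟩ φ = ∼ [ π ] ∼ φ

skip : Program n
skip = test ⊤

-- ε is used for the empty list only.  A plain foldr would be wrong for
-- the union of programs, of which skip is not a neutral element.
fold₁ : {A : Set} → (A → A → A) → A → List A → A
fold₁ _∙_ ε []           = ε
fold₁ _∙_ ε (x ∷ [])     = x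
fold₁ _∙_ ε (x ∷ y ∷ xs) = x ∙ fold₁ _∙_ ε (y ∷ xs)

⨾-over ∪-over : List (Prp n) → (Prp n → Program n) → Program n
⨾-over P π = fold₁ _⨾_ skip (map π P)
∪-over P π = fold₁ _∪_ skip (map π P)

⋀ ⋁ : (Fin n → Formula n) → Formula n
⋀ {n} φ = fold₁ _∧_ ⊤ (map φ (allFin n))
⋁ {n} φ = fold₁ _∨_ ⊥ (map φ (allFin n))

mkTrueOne mkFalseOne mkTrueSome mkFalseSome vary : List (Prp n) → Program n
mkTrueOne   P = ∪-over P λ p → test (∼ var p) ⨾ + p
mkFalseOne  P = ∪-over P λ p → test (var p) ⨾ - p
mkTrueSome  P = ⨾-over P λ p → + p ∪ skip
mkFalseSome P = ⨾-over P λ p → - p ∪ skip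
vary        P = ⨾-over P λ p → + p ∪ - p

-- Finite sets of variables are duplicate-free lists.
elements : Subset n → List (Fin n)
elements {n} A = filter (_∈? A) (allFin n)

IN AW ATT² Prp[_] : Subset n → List (Prp n)
IN   A = map in° (elements A)
AW   A = map aw (elements A)
ATT² A = cartesianProductWith r (elements A) (elements A)
Prp[ A ] = AW A ++ IN A ++ ATT² A

IN-U : List (Prp n)
IN-U = IN Subset.⊤

extend : Formula n → Program n
extend φ = vary IN-U ⨾ test φ

Well ConFree Admissible Stable Complete Grounded Preferred Naive : Formula n

Well = ⋀ λ x → var (in° x) ⇒ var (aw x)

ConFree = Well ∧ ⋀ λ x → ⋀ λ y →
  ∼ (var (in° x) ∧ var (in° y) ∧ var (r x y))

defended : Fin n → Formula n
defended x = ⋀ λ y → (var (aw y) ∧ var (r y x)) ⇒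
                     ⋁ λ z → var (in° z) ∧ var (r z y)

Admissible = ConFree ∧ ⋀ λ x → var (in° x) ⇒ defended x

Stable = Well ∧ ⋀ λ x → var (aw x) ⇒
  (var (in° x) ⇔ ∼ (⋁ λ y → var (in° y) ∧ var (r y x)))

-- The published formula has no guard aw x; it is added here because
-- correctness fails without it: an argument outside A_v without attackers in A_v
-- satisfies defended x, so that without the guard in° x would be forced,
-- contradicting Well, and Complete would be unsatisfiable.
Complete = ConFree ∧ ⋀ λ x → var (aw x) ⇒ (var (in° x) ⇔ defended x)

Grounded = Complete ∧ [ mkFalseOne IN-U ⨾ mkFalseSome IN-U ] ∼ Complete

Preferred = Admissible ∧ [ mkTrueOne IN-U ⨾ mkTrueSome IN-U ] ∼ Admissible

Naive = ConFree ∧ [ mkTrueOne IN-U ] ∼ ConFree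

copy : Program n
copy {n} = fold₁ _⨾_ skip (map copy₁ (allFin n))
  where
  copy₁ : Fin n → Program n
  copy₁ x = (test (var (in° x)) ⨾ + in′ x) ∪ (test (∼ var (in° x)) ⨾ - in′ x)

Rg Rg′ : Fin n → Formula n
Rg  x = var (in° x) ∨ (var (aw x) ∧ ⋁ λ y → var (in° y) ∧ var (r y x))
Rg′ x = var (in′ x) ∨ (var (aw x) ∧ ⋁ λ y → var (in′ y) ∧ var (r y x))

IncludedInCp IncludesCp SemiStable Stage : Formula n

IncludedInCp = ⋀ λ x → Rg x ⇒ Rg′ x
IncludesCp   = ⋀ λ x → Rg′ x ⇒ Rg x

SemiStable = Complete ∧ [ copy ⨾ extend Complete ] (IncludesCp ⇒ IncludedInCp)

Stage = ConFree ∧ [ copy ⨾ vary IN-U ⨾ test ConFree ] (IncludesCp ⇒ IncludedInCp)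

IdealSet EagerSet Ideal Eager : Formula n

IdealSet = Admissible ∧ ⋀ λ x → var (in° x) ⇒ [ extend Preferred ] var (in° x)
EagerSet = Admissible ∧ ⋀ λ x → var (in° x) ⇒ [ extend SemiStable ] var (in° x)

Ideal = IdealSet ∧ [ mkTrueOne IN-U ⨾ mkTrueSome IN-U ] ∼ IdealSet
Eager = EagerSet ∧ [ mkTrueOne IN-U ⨾ mkTrueSome IN-U ] ∼ EagerSet

extensionFormula : Semantics → Formula n
extensionFormula st  = Stable
extensionFormula co  = Complete
extensionFormula gr  = Grounded
extensionFormula pr  = Preferred
extensionFormula se  = SemiStable
extensionFormula id  = Ideal
extensionFormula ea  = Eager
extensionFormula na  = Naive
extensionFormula stg = Stage

makeExt : Semantics → Program n
makeExt σ = extend (extensionFormula σ)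

data BooleanOver (P : List (Prp n)) : Formula n → Set where
  var : ∀ {p} → p ∈ˡ P → BooleanOver P (var p)
  ∼_  : ∀ {φ} → BooleanOver P φ → BooleanOver P (∼ φ)
  _∧_ : ∀ {φ ψ} → BooleanOver P φ → BooleanOver P ψ → BooleanOver P (φ ∧ ψ)

record CIAF (n : ℕ) : Set where
  constructor ciaf
  field
    arguments  : Subset n
    constraint : Formula n
    boolean    : BooleanOver (AW arguments ++ ATT² arguments) constraint

open CIAF public

-- The framework (A_v , R_v).
⌊_⌋ : Valuation n → AF n
⌊_⌋ {n} v = af A R R⊆A×A
  where
  A : Subset n
  A = tabulate λ x → v (aw x)

  R : Vec (Subset n) n
  R = tabulate λ x → tabulate λ y → (v (aw x) Bool.∧ v (aw y)) Bool.∧ v (r x y)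

  ∈A : ∀ {x} → v (aw x) ≡ true → x Subset.∈ A
  ∈A {x} eq = lookup⇒[]= x A (trans (lookup∘tabulate _ x) eq)

  ∧⁻ : ∀ b {c} → b Bool.∧ c ≡ true → b ≡ true × c ≡ true
  ∧⁻ true eq = refl , eq

  R⊆A×A : ∀ {x y} → y Subset.∈ lookup R x → x Subset.∈ A × y Subset.∈ A
  R⊆A×A {x} {y} xRy = ∈A (proj₁ both) , ∈A (proj₂ both)
    where
    row : y Subset.∈ tabulate (λ y → (v (aw x) Bool.∧ v (aw y)) Bool.∧ v (r x y))
    row = subst (y Subset.∈_) (lookup∘tabulate _ x) xRy

    both : v (aw x) ≡ true × v (aw y) ≡ true
    both = ∧⁻ (v (aw x)) (proj₁ (∧⁻ (v (aw x) Bool.∧ v (aw y))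
             (trans (sym (lookup∘tabulate _ y)) ([]=⇒lookup row))))

Completion : CIAF n → Pred (AF n) 0ℓ
Completion c F =
  ∃[ v ] (⟦ v ⟧ᵛ U.⊆ (_∈ˡ Prp[ arguments c ]) × (v ⊨ constraint c) × F ≡ ⌊ v ⌋)

NSA NCA PCA PSA : Semantics → CIAF n → Fin n → Set
NSA σ c a = ∀ F → Completion c F → ∀ E → Extension σ F E → a Subset.∈ E
NCA σ c a = ∀ F → Completion c F → ∃[ E ] (Extension σ F E × a Subset.∈ E)
PCA σ c a = ∃[ F ] (Completion c F × ∃[ E ] (Extension σ F E × a Subset.∈ E))
PSA σ c a = ∃[ F ] (Completion c F × (∀ E → Extension σ F E → a Subset.∈ E))

v-cIAF : CIAF n → Valuation n
v-cIAF _ = ∅ᵛ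

makeComp : CIAF n → Program n
makeComp c = vary (AW (arguments c)) ⨾ vary (ATT² (arguments c)) ⨾ test (constraint c)

{-# OPTIONS --safe #-}
-- A valuation v encodes the framework ⌊ v ⌋ together with the set ins v, and each extension
-- formula holds at v exactly when ins v is such an extension of ⌊ v ⌋.  The programs occurring
-- in these formulas change only the in-variables (and their copies), so a box over them
-- quantifies over all, all larger, or all smaller sets for the same framework.  The formula
-- Preferred speaks of maximal admissible sets, which are the maximal complete ones by Dung's
-- fundamental lemma.  Diamonds are negated boxes and only give double negations of the
-- existential statements about extensions and completions; these are removed by finite search.
module Submission where

open import Defs
open import Data.Bool.Base as Bool using (Bool; true; false; not; _≤_; b≤b; f≤t)
open import Data.Bool.Properties as Boolₚ using (⇔→≡; ¬-not; not-¬; ≤-refl; ≤-trans)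
open import Data.Fin.Base as Fin using (Fin)
import Data.Fin.Properties as Finₚ
open import Data.Fin.Subset as Subset using (Subset; _∈_; _⊆_; _⊂_; ⁅_⁆)
open import Data.Fin.Subset.Induction using (⊃-wellFounded; Acc; acc)
open import Data.Fin.Subset.Properties
  using (_∈?_; _⊆?_; _⊂?_; ⊂-trans; anySubset?; ∈⊤; ∉⊥; x∈⁅x⁆;
         x∈⁅y⁆⇒x≡y; x∈p∪q⁺; x∈p∪q⁻)
open import Data.List.Base using (List; []; _∷_; _++_; map; allFin)
open import Data.List.Membership.Propositional using () renaming (_∈_ to _∈ˡ_; _∉_ to _∉ˡ_)
import Data.List.Membership.DecPropositional as ListDec
open import Data.List.Membership.Propositional.Properties
  using (∈-map⁺; ∈-map⁻; ∈-filter⁺; ∈-allFin; ∈-++⁺ˡ; ∈-++⁺ʳ; ∈-++⁻; ∈-cartesianProductWith⁻)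
open import Data.List.Relation.Unary.Any using (here; there)
open import Data.Nat.Base using (ℕ; NonZero; ≢-nonZero⁻¹)
import Data.Nat.Properties as ℕₚ
open import Data.Product.Base as Product using (_×_; _,_; proj₁; proj₂; ∃-syntax; uncurry)
import Data.Product.Properties as Productₚ
open import Data.Sum.Base as Sum using (_⊎_; inj₁; inj₂; [_,_]′)
import Data.Sum.Properties as Sumₚ
open import Data.Unit.Base using () renaming (⊤ to Unit)
open import Data.Vec.Base using (lookup; tabulate)
open import Data.Vec.Properties
  using (lookup∘tabulate; tabulate∘lookup; tabulate-cong; lookup⇒[]=; []=⇒lookup)
open import Function.Base using (_∘_; flip)
open import Function.Bundles using (mk⇔; Equivalence) renaming (_⇔_ to _iff_)
open import Function.Properties.Equivalence using () renaming (trans to iff-trans)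
open import Level using (0ℓ)
open import Relation.Binary.Core using (Rel)
open import Relation.Binary.Definitions using (DecidableEquality; Reflexive; Transitive)
open import Relation.Binary.PropositionalEquality
  using (_≡_; _≢_; _≗_; refl; sym; trans; cong; cong₂; subst; ≢-sym)
open import Relation.Nullary using (Dec; yes; no; ¬_; does)
open import Relation.Nullary.Decidable
  using (decidable-stable; map′; ¬?; _×-dec_; _⊎-dec_; _→-dec_; dec-true; dec-false)
open import Relation.Nullary.Negation using (contradiction; negated-stable; ¬¬-map)
import Relation.Unary as U
open import Relation.Unary using (Pred)

open Equivalence using (to; from)

-- Three obstacles shape the proof. Valuations are functions that programs relate only up to
-- extensional equality, so the whole semantics has to be shown invariant under `≗` before states
-- can be exchanged. The empty union is `skip`: over an empty universe `mkTrueOne IN-U` could stay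
-- in place, and `[ mkTrueOne IN-U ⨾ mkTrueSome IN-U ] ∼ φ` would contradict `φ`; `NonZero n`
-- excludes this wherever maximality or minimality is expressed. Boxes range over infinitely many
-- valuations, so on the formula side only stability is proved, while decidability is obtained on
-- the side of sets and frameworks. Correspondences between formulas and predicates on sets are
-- stated for all valuations at once. They can therefore be applied to the states visited by a box,
-- and passing to maximal, minimal or range-maximal sets, or to sets contained in all sets of
-- another kind, preserves them; the nested formulas `Ideal` and `Eager` are compositions of these
-- steps.

private
  variable
    n : ℕ

-- Classical reasoning about formulas

-- _⊨_ lies in the negative fragment of logic, so classical reasoning about formulas does
-- not require ∥_∥ to be decidable.
⊨-stable : ∀ (φ : Formula n) {v} → ¬ ¬ (v ⊨ φ) → v ⊨ φ
⊨-stable (var p) {v} = decidable-stable (v p Boolₚ.≟ true)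
⊨-stable (∼ φ)       = negated-stable
⊨-stable (φ ∧ ψ) h   = ⊨-stable φ (¬¬-map proj₁ h) , ⊨-stable ψ (¬¬-map proj₂ h)
⊨-stable ([ π ] φ) h v′ s = ⊨-stable φ (¬¬-map (λ k → k v′ s) h)

⇒-elim : ∀ (v : Valuation n) φ ψ → v ⊨ φ ⇒ ψ → v ⊨ φ → v ⊨ ψ
⇒-elim v φ ψ h p = ⊨-stable ψ (λ k → h (p , k))

⇒-intro : ∀ (v : Valuation n) φ ψ → (v ⊨ φ → v ⊨ ψ) → v ⊨ φ ⇒ ψ
⇒-intro v φ ψ f (p , ¬q) = ¬q (f p)

⊨⊤ : ∀ (v : Valuation n) → v ⊨ ⊤
⊨⊤ v (¬p , ¬¬p) = ¬¬p ¬p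

module _ {I : Set} (φ : I → Formula n) (v : Valuation n) where

  fold-∧⁺ : ∀ is → (∀ i → v ⊨ φ i) → v ⊨ fold₁ _∧_ ⊤ (map φ is)
  fold-∧⁺ []           h = ⊨⊤ v
  fold-∧⁺ (i ∷ [])     h = h i
  fold-∧⁺ (i ∷ j ∷ is) h = h i , fold-∧⁺ (j ∷ is) h

  fold-∧⁻ : ∀ {is i} → v ⊨ fold₁ _∧_ ⊤ (map φ is) → i ∈ˡ is → v ⊨ φ i
  fold-∧⁻ {_ ∷ []}    h       (here refl) = h
  fold-∧⁻ {_ ∷ _ ∷ _} (h , _) (here refl) = h
  fold-∧⁻ {_ ∷ _ ∷ _} (_ , h) (there i∈)  = fold-∧⁻ h i∈

  fold-∨⁺ : ∀ {is i} → i ∈ˡ is → v ⊨ φ i → v ⊨ fold₁ _∨_ ⊥ (map φ is)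
  fold-∨⁺ {_ ∷ []}    (here refl) p = p
  fold-∨⁺ {_ ∷ _ ∷ _} (here refl) p = λ (¬p , _) → ¬p p
  fold-∨⁺ {_ ∷ _ ∷ _} (there i∈)  p = λ (_ , ¬q) → ¬q (fold-∨⁺ i∈ p)

  -- Disjunction abbreviates a negated conjunction, so a witness comes only under a double negation.
  fold-∨⁻ : ∀ is → v ⊨ fold₁ _∨_ ⊥ (map φ is) → ¬ ¬ (∃[ i ] v ⊨ φ i)
  fold-∨⁻ []           h k = h (⊨⊤ v)
  fold-∨⁻ (i ∷ [])     h k = k (i , h)
  fold-∨⁻ (i ∷ j ∷ is) h k = h ((λ p → k (i , p)) , λ q → fold-∨⁻ (j ∷ is) q k)

module _ (φ : Fin n → Formula n) (v : Valuation n) where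

  ⋀⁺ : (∀ x → v ⊨ φ x) → v ⊨ ⋀ φ
  ⋀⁺ = fold-∧⁺ φ v (allFin n)

  ⋀⁻ : v ⊨ ⋀ φ → ∀ x → v ⊨ φ x
  ⋀⁻ h x = fold-∧⁻ φ v h (∈-allFin x)

  ⋁⁺ : ∀ x → v ⊨ φ x → v ⊨ ⋁ φ
  ⋁⁺ x = fold-∨⁺ φ v (∈-allFin x)

  ⋁⁻ : v ⊨ ⋁ φ → ¬ ¬ (∃[ x ] v ⊨ φ x)
  ⋁⁻ = fold-∨⁻ φ v (allFin n)

-- Programs as relations on valuations

private
  -- A retraction into a sum type, through which `Prp` inherits decidable equality without a
  -- comparison of every pair of constructors.
  encode : Prp n → (Fin n ⊎ Fin n ⊎ Fin n) ⊎ (Fin n × Fin n) ⊎ ℕ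
  encode (aw x)    = inj₁ (inj₁ x)
  encode (in° x)   = inj₁ (inj₂ (inj₁ x))
  encode (in′ x)   = inj₁ (inj₂ (inj₂ x))
  encode (r x y)   = inj₂ (inj₁ (x , y))
  encode (other k) = inj₂ (inj₂ k)

  decode : (Fin n ⊎ Fin n ⊎ Fin n) ⊎ (Fin n × Fin n) ⊎ ℕ → Prp n
  decode = [ [ aw , [ in° , in′ ]′ ]′ , [ uncurry r , other ]′ ]′

  decode∘encode : (p : Prp n) → decode (encode p) ≡ p
  decode∘encode (aw x)    = refl
  decode∘encode (in° x)   = refl
  decode∘encode (in′ x)   = refl
  decode∘encode (r x y)   = refl
  decode∘encode (other k) = refl

infix 4 _≟_

_≟_ : DecidableEquality (Prp n)
p ≟ q = map′
  (λ eq → trans (sym (decode∘encode p)) (trans (cong decode eq) (decode∘encode q)))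
  (cong encode)
  (Sumₚ.≡-dec (Sumₚ.≡-dec Finₚ._≟_ (Sumₚ.≡-dec Finₚ._≟_ Finₚ._≟_))
              (Sumₚ.≡-dec (Productₚ.≡-dec Finₚ._≟_ Finₚ._≟_) ℕₚ._≟_)
              (encode p) (encode q))

AgreeOutside : List (Prp n) → Rel (Valuation n) 0ℓ
AgreeOutside P v v′ = ∀ q → q ∉ˡ P → v′ q ≡ v q

Assigns : Prp n → Bool → Rel (Valuation n) 0ℓ
Assigns p b v v′ = v′ p ≡ b × (∀ q → q ≢ p → v′ q ≡ v q)

update : Valuation n → Prp n → Bool → Valuation n
update v p b q = Bool.if does (q ≟ p) then b else v q

update-assigns : ∀ (v : Valuation n) p b → Assigns p b v (update v p b)
update-assigns v p b =
    cong (Bool.if_then b else v p) (dec-true (p ≟ p) refl)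
  , λ q q≢p → cong (Bool.if_then b else v q) (dec-false (q ≟ p) q≢p)

≐⇒≗ : ∀ {v v′ : Valuation n} → ⟦ v ⟧ᵛ U.≐ ⟦ v′ ⟧ᵛ → v ≗ v′
≐⇒≗ (f , g) p = ⇔→≡ {z = true} (mk⇔ f g)

≗⇒≐ : ∀ {v v′ : Valuation n} → v ≗ v′ → ⟦ v ⟧ᵛ U.≐ ⟦ v′ ⟧ᵛ
≗⇒≐ eq = (λ {p} → trans (sym (eq p))) , (λ {p} → trans (eq p))

plus-assigns : ∀ p {v v′ : Valuation n} → ∥ + p ∥ v v′ iff Assigns p true v v′
plus-assigns p {v} {v′} = mk⇔
  (λ (f , g) → g (inj₂ refl) , λ q q≢p → ⇔→≡ {z = true}
    (mk⇔ (λ eq → [ (λ h → h) , (λ p≡q → contradiction (sym p≡q) q≢p) ]′ (f eq)) (g ∘ inj₁)))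
  (λ (at , off) →
      (λ {q} eq → fwd at off q eq)
    , λ {q} → [ bwd at off q , (λ { refl → at }) ]′)
  where
  fwd : v′ p ≡ true → (∀ q → q ≢ p → v′ q ≡ v q) → ∀ q → v′ q ≡ true → v q ≡ true ⊎ p ≡ q
  fwd at off q eq with q ≟ p
  ... | yes q≡p = inj₂ (sym q≡p)
  ... | no  q≢p = inj₁ (trans (sym (off q q≢p)) eq)

  bwd : v′ p ≡ true → (∀ q → q ≢ p → v′ q ≡ v q) → ∀ q → v q ≡ true → v′ q ≡ true
  bwd at off q eq with q ≟ p
  ... | yes refl = at
  ... | no  q≢p  = trans (off q q≢p) eq

minus-assigns : ∀ p {v v′ : Valuation n} → ∥ - p ∥ v v′ iff Assigns p false v v′
minus-assigns p {v} {v′} = mk⇔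
  (λ (f , g) → ¬-not (λ eq → proj₂ (f eq) refl) , λ q q≢p → ⇔→≡ {z = true}
    (mk⇔ (proj₁ ∘ f) (λ eq → g (eq , ≢-sym q≢p))))
  (λ (at , off) →
      (λ {q} eq → let p≢q = λ { refl → contradiction (trans (sym at) eq) λ () } in
                  trans (sym (off q (≢-sym p≢q))) eq , p≢q)
    , λ {q} (eq , p≢q) → trans (off q (≢-sym p≢q)) eq)

assigns-resp : ∀ {p b} {v v′ w w′ : Valuation n} → v ≗ w → v′ ≗ w′ →
               Assigns p b v v′ → Assigns p b w w′
assigns-resp {p = p} v≗w v′≗w′ (at , off) =
    trans (sym (v′≗w′ p)) at
  , λ q q≢p → trans (sym (v′≗w′ q)) (trans (off q q≢p) (v≗w q))

mutual
  -- Replaces function extensionality: valuations with equal values need not be propositionally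
  -- equal. Tests contain formulas and boxes contain programs, hence the mutual induction.
  ⊨-resp : ∀ (φ : Formula n) {v w} → v ≗ w → v ⊨ φ → w ⊨ φ
  ⊨-resp (var p)   v≗w h = trans (sym (v≗w p)) h
  ⊨-resp (∼ φ)     v≗w h = h ∘ ⊨-resp φ (sym ∘ v≗w)
  ⊨-resp (φ ∧ ψ)   v≗w h = Product.map (⊨-resp φ v≗w) (⊨-resp ψ v≗w) h
  ⊨-resp ([ π ] φ) v≗w h = λ v′ s → h v′ (∥∥-resp π (sym ∘ v≗w) (λ _ → refl) s)

  ∥∥-resp : ∀ (π : Program n) {v w v′ w′} → v ≗ w → v′ ≗ w′ → ∥ π ∥ v v′ → ∥ π ∥ w w′
  ∥∥-resp (+ p) v≗w v′≗w′ = from (plus-assigns p) ∘ assigns-resp v≗w v′≗w′ ∘ to (plus-assigns p)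
  ∥∥-resp (- p) v≗w v′≗w′ = from (minus-assigns p) ∘ assigns-resp v≗w v′≗w′ ∘ to (minus-assigns p)
  ∥∥-resp (test φ) v≗w v′≗w′ (eq , h) =
      ≗⇒≐ (λ p → trans (sym (v′≗w′ p)) (trans (≐⇒≗ eq p) (v≗w p)))
    , ⊨-resp φ v≗w h
  ∥∥-resp (π ⨾ ρ) v≗w v′≗w′ (u , s , t) =
    u , ∥∥-resp π v≗w (λ _ → refl) s , ∥∥-resp ρ (λ _ → refl) v′≗w′ t
  ∥∥-resp (π ∪ ρ) v≗w v′≗w′ = Sum.map (∥∥-resp π v≗w v′≗w′) (∥∥-resp ρ v≗w v′≗w′)
  ∥∥-resp (π ⁻¹)  v≗w v′≗w′ = ∥∥-resp π v′≗w′ v≗w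

skip⁺ : ∀ {v v′ : Valuation n} → v ≗ v′ → ∥ skip ∥ v v′
skip⁺ {v = v} v≗v′ = ≗⇒≐ (sym ∘ v≗v′) , ⊨⊤ v

skip⁻ : ∀ {v v′ : Valuation n} → ∥ skip ∥ v v′ → v ≗ v′
skip⁻ (eq , _) = sym ∘ ≐⇒≗ eq

module _ {I : Set} (π : I → Program n) where

  fold-⨾-total : (∀ i v → ∃[ v′ ] ∥ π i ∥ v v′) →
                 ∀ is v → ∃[ v′ ] ∥ fold₁ _⨾_ skip (map π is) ∥ v v′
  fold-⨾-total total []           v = v , skip⁺ (λ _ → refl)
  fold-⨾-total total (i ∷ [])     v = total i v
  fold-⨾-total total (i ∷ j ∷ is) v =
    let u , s  = total i v
        v′ , t = fold-⨾-total total (j ∷ is) u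
    in v′ , u , s , t

  module _ (T : List I → Rel (Valuation n) 0ℓ) where

    -- An induction principle with `T` indexed by the variables still to be processed. `fold₁` ends
    -- in the last program and not in `skip`, so for a singleton the missing `T []` is supplied by
    -- `base` at equal states.
    fold-⨾⁻ : (∀ {v v′} → v ≗ v′ → T [] v v′) →
              (∀ i is {v u v′} → ∥ π i ∥ v u → T is u v′ → T (i ∷ is) v v′) →
              ∀ is {v v′} → ∥ fold₁ _⨾_ skip (map π is) ∥ v v′ → T is v v′
    fold-⨾⁻ base step []           s           = base (skip⁻ s)
    fold-⨾⁻ base step (i ∷ [])     s           = step i [] s (base λ _ → refl)
    fold-⨾⁻ base step (i ∷ j ∷ is) (u , s , t) =
      step i (j ∷ is) s (fold-⨾⁻ base step (j ∷ is) t)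

    fold-⨾⁺ : (∀ {v v′} → T [] v v′ → v ≗ v′) →
              (∀ i is {v v′} → T (i ∷ is) v v′ → ∃[ u ] (∥ π i ∥ v u × T is u v′)) →
              ∀ is {v v′} → T is v v′ → ∥ fold₁ _⨾_ skip (map π is) ∥ v v′
    fold-⨾⁺ base step []           t = skip⁺ (base t)
    fold-⨾⁺ base step (i ∷ [])     t =
      -- The state `u` agrees with `v′` only pointwise.
      let u , s , t′ = step i [] t in ∥∥-resp (π i) (λ _ → refl) (base t′) s
    fold-⨾⁺ base step (i ∷ j ∷ is) t =
      let u , s , t′ = step i (j ∷ is) t in u , s , fold-⨾⁺ base step (j ∷ is) t′

  fold-∪⁺ : ∀ {is i v v′} → i ∈ˡ is → ∥ π i ∥ v v′ → ∥ fold₁ _∪_ skip (map π is) ∥ v v′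
  fold-∪⁺ {_ ∷ []}    (here refl) s = s
  fold-∪⁺ {_ ∷ _ ∷ _} (here refl) s = inj₁ s
  fold-∪⁺ {_ ∷ _ ∷ _} (there i∈)  s = inj₂ (fold-∪⁺ i∈ s)

  -- The member `j` witnesses that the list is non-empty; an empty union is `skip` and executes none
  -- of the `π i`.
  fold-∪⁻ : ∀ {is j v v′} → j ∈ˡ is → ∥ fold₁ _∪_ skip (map π is) ∥ v v′ →
            ∃[ i ] (i ∈ˡ is × ∥ π i ∥ v v′)
  fold-∪⁻ {i ∷ []}     _ s        = i , here refl , s
  fold-∪⁻ {i ∷ _ ∷ _}  _ (inj₁ s) = i , here refl , s
  fold-∪⁻ {_ ∷ is@(_ ∷ _)} _ (inj₂ s) =
    let i , i∈ , t = fold-∪⁻ {is} (here refl) s in i , there i∈ , t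

-- Covers three programs at once: `Q` is the total relation for `vary`, `_≤_` for `mkTrueSome` and
-- its converse for `mkFalseSome`.
Changes : Rel Bool 0ℓ → List (Prp n) → Rel (Valuation n) 0ℓ
Changes Q P v v′ = AgreeOutside P v v′ × (∀ q → Q (v q) (v′ q))

module _ {Q : Rel Bool 0ℓ} (Q-refl : Reflexive Q) (Q-trans : Transitive Q)
         (π : Prp n → Program n)
         (step : ∀ p {v v′} →
                 ∥ π p ∥ v v′ iff ((∀ q → q ≢ p → v′ q ≡ v q) × Q (v p) (v′ p)))
  where

  private
    ≡⇒Q : ∀ {b c} → b ≡ c → Q b c
    ≡⇒Q refl = Q-refl

  -- Transitivity of `Q` composes the changes along the sequence. Conversely, the first program can
  -- move `p` straight to its final value, and the rest is a change on the remaining list.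
  ⨾-over-changes : ∀ P {v v′} → ∥ ⨾-over P π ∥ v v′ iff Changes Q P v v′
  ⨾-over-changes P = mk⇔
    (fold-⨾⁻ π (Changes Q) (λ eq → (λ q _ → sym (eq q)) , λ q → ≡⇒Q (eq q)) sound P)
    (fold-⨾⁺ π (Changes Q) (λ (agree , _) q → sym (agree q λ ())) complete P)
    where
    sound : ∀ p P {v u v′} → ∥ π p ∥ v u → Changes Q P u v′ → Changes Q (p ∷ P) v v′
    sound p P {v} {u} {v′} s (agree , rel) =
        (λ q q∉ → trans (agree q (q∉ ∘ there)) (off q (q∉ ∘ here)))
      , λ q → Q-trans (v≲u q) (rel q)
      where
      off = proj₁ (to (step p) s)
      v≲u : ∀ q → Q (v q) (u q)
      v≲u q with q ≟ p
      ... | yes refl = proj₂ (to (step p) s)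
      ... | no  q≢p  = ≡⇒Q (sym (off q q≢p))

    complete : ∀ p P {v v′} → Changes Q (p ∷ P) v v′ →
               ∃[ u ] (∥ π p ∥ v u × Changes Q P u v′)
    complete p P {v} {v′} (agree , rel) =
        u
      , from (step p) (off , subst (Q (v p)) (sym at) (rel p))
      , agree′ , rel′
      where
      u = update v p (v′ p)
      at = proj₁ (update-assigns v p (v′ p))
      off = proj₂ (update-assigns v p (v′ p))

      agree′ : AgreeOutside P u v′
      agree′ q q∉ with q ≟ p
      ... | yes refl = sym at
      ... | no  q≢p  = trans (agree q λ { (here q≡p) → q≢p q≡p ; (there q∈) → q∉ q∈ })
                             (sym (off q q≢p))

      rel′ : ∀ q → Q (u q) (v′ q)
      rel′ q with q ≟ p
      ... | yes refl = ≡⇒Q at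
      ... | no  q≢p  = subst (λ b → Q b (v′ q)) (sym (off q q≢p)) (rel q)

≗-by-cases : ∀ p {v v′ : Valuation n} → (∀ q → q ≢ p → v′ q ≡ v q) → v p ≡ v′ p → v ≗ v′
≗-by-cases p off at q with q ≟ p
... | yes refl = at
... | no  q≢p  = sym (off q q≢p)

vary-changes : ∀ (P : List (Prp n)) {v v′} → ∥ vary P ∥ v v′ iff AgreeOutside P v v′
vary-changes P = iff-trans
  (⨾-over-changes {Q = λ _ _ → Unit} _ _ (λ p → + p ∪ - p) step P)
  (mk⇔ proj₁ (_, _))
  where
  step : ∀ p {v v′} → ∥ + p ∪ - p ∥ v v′ iff ((∀ q → q ≢ p → v′ q ≡ v q) × Unit)
  step p {v} {v′} = mk⇔
    [ (λ s → proj₂ (to (plus-assigns p) s) , _) , (λ s → proj₂ (to (minus-assigns p) s) , _) ]′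
    (λ (off , _) → choose (v′ p) refl off)
    where
    choose : ∀ b → v′ p ≡ b → (∀ q → q ≢ p → v′ q ≡ v q) → ∥ + p ∪ - p ∥ v v′
    choose true  at off = inj₁ (from (plus-assigns p) (at , off))
    choose false at off = inj₂ (from (minus-assigns p) (at , off))

≤-true : ∀ {b c} → (b ≡ true → c ≡ true) → b ≤ c
≤-true {false} {false} _ = b≤b
≤-true {false} {true}  _ = f≤t
≤-true {true}          f = subst (true ≤_) (sym (f refl)) b≤b

true-≤ : ∀ {b c} → b ≤ c → b ≡ true → c ≡ true
true-≤ b≤b eq = eq

mkTrueSome-changes : ∀ (P : List (Prp n)) {v v′} →
                     ∥ mkTrueSome P ∥ v v′ iff Changes _≤_ P v v′
mkTrueSome-changes P = ⨾-over-changes {Q = _≤_} ≤-refl ≤-trans (λ p → + p ∪ skip) step P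
  where
  step : ∀ p {v v′} → ∥ + p ∪ skip ∥ v v′ iff ((∀ q → q ≢ p → v′ q ≡ v q) × v p ≤ v′ p)
  step p {v} {v′} = mk⇔
    [ (λ s → let at , off = to (plus-assigns p) s in off , ≤-true (λ _ → at))
    , (λ s → (λ q _ → sym (skip⁻ s q)) , Boolₚ.≤-reflexive (skip⁻ s p)) ]′
    (λ (off , v≤v′) → choose (v′ p) refl off v≤v′)
    where
    choose : ∀ b → v′ p ≡ b → (∀ q → q ≢ p → v′ q ≡ v q) → v p ≤ v′ p → ∥ + p ∪ skip ∥ v v′
    choose true  at off _    = inj₁ (from (plus-assigns p) (at , off))
    choose false at off v≤v′ = inj₂ (skip⁺ (≗-by-cases p off
      (Boolₚ.≤-antisym v≤v′ (subst (_≤ v p) (sym at) (Boolₚ.≤-minimum (v p))))))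

mkFalseSome-changes : ∀ (P : List (Prp n)) {v v′} →
                      ∥ mkFalseSome P ∥ v v′ iff Changes (flip _≤_) P v v′
mkFalseSome-changes P =
  ⨾-over-changes {Q = flip _≤_} ≤-refl (λ c≤b d≤c → ≤-trans d≤c c≤b) (λ p → - p ∪ skip) step P
  where
  step : ∀ p {v v′} → ∥ - p ∪ skip ∥ v v′ iff ((∀ q → q ≢ p → v′ q ≡ v q) × v′ p ≤ v p)
  step p {v} {v′} = mk⇔
    [ (λ s → let at , off = to (minus-assigns p) s in
             off , subst (_≤ v p) (sym at) (Boolₚ.≤-minimum (v p)))
    , (λ s → (λ q _ → sym (skip⁻ s q)) , Boolₚ.≤-reflexive (sym (skip⁻ s p))) ]′
    (λ (off , v′≤v) → choose (v′ p) refl off v′≤v)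
    where
    choose : ∀ b → v′ p ≡ b → (∀ q → q ≢ p → v′ q ≡ v q) → v′ p ≤ v p → ∥ - p ∪ skip ∥ v v′
    choose false at off _    = inj₁ (from (minus-assigns p) (at , off))
    choose true  at off v′≤v = inj₂ (skip⁺ (≗-by-cases p off
      (trans (true-≤ v′≤v at) (sym at))))

-- The framework and the set of arguments encoded by a valuation

ins cps : Valuation n → Subset n
ins v = tabulate (v ∘ in°)
cps v = tabulate (v ∘ in′)

∈-tabulate⁺ : ∀ {f : Fin n → Bool} {x} → f x ≡ true → x ∈ tabulate f
∈-tabulate⁺ {f = f} {x} eq = lookup⇒[]= x (tabulate f) (trans (lookup∘tabulate f x) eq)

∈-tabulate⁻ : ∀ {f : Fin n → Bool} {x} → x ∈ tabulate f → f x ≡ true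
∈-tabulate⁻ {f = f} {x} x∈ = trans (sym (lookup∘tabulate f x)) ([]=⇒lookup x∈)

∧-true⁺ : ∀ {b c} → b ≡ true → c ≡ true → b Bool.∧ c ≡ true
∧-true⁺ refl refl = refl

∧-true⁻ : ∀ b {c} → b Bool.∧ c ≡ true → b ≡ true × c ≡ true
∧-true⁻ true eq = refl , eq

Attacks⁺ : ∀ (v : Valuation n) {x y} → v (aw x) ≡ true → v (aw y) ≡ true →
           v (r x y) ≡ true → Attacks ⌊ v ⌋ x y
Attacks⁺ v {x} {y} awx awy rxy = subst (y ∈_) (sym (lookup∘tabulate _ x))
  (∈-tabulate⁺ (∧-true⁺ (∧-true⁺ awx awy) rxy))

Attacks⁻ : ∀ (v : Valuation n) {x y} → Attacks ⌊ v ⌋ x y → v (r x y) ≡ true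
Attacks⁻ v {x} {y} xRy =
  proj₂ (∧-true⁻ (v (aw x) Bool.∧ v (aw y))
    (∈-tabulate⁻ (subst (y ∈_) (lookup∘tabulate _ x) xRy)))

AF-≡ : ∀ {F G : AF n} → args F ≡ args G → attacks F ≡ attacks G → F ≡ G
AF-≡ {F = af _ _ _} {af _ _ _} refl refl = refl

⌊⌋-cong : ∀ {v w : Valuation n} → (∀ x → v (aw x) ≡ w (aw x)) →
          (∀ x y → v (r x y) ≡ w (r x y)) → ⌊ v ⌋ ≡ ⌊ w ⌋
⌊⌋-cong aw≡ r≡ = AF-≡
  (tabulate-cong aw≡)
  (tabulate-cong λ x → tabulate-cong λ y →
    cong₂ Bool._∧_ (cong₂ Bool._∧_ (aw≡ x) (aw≡ y)) (r≡ x y))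

elements⁺ : ∀ {A : Subset n} {x} → x ∈ A → x ∈ˡ elements A
elements⁺ {A = A} {x} = ∈-filter⁺ (_∈? A) (∈-allFin x)

in°∈IN-U : ∀ (x : Fin n) → in° x ∈ˡ IN-U
in°∈IN-U x = ∈-map⁺ in° (elements⁺ ∈⊤)

∈IN-U⁻ : ∀ {p : Prp n} → p ∈ˡ IN-U → ∃[ x ] p ≡ in° x
∈IN-U⁻ p∈ = let x , _ , eq = ∈-map⁻ in° p∈ in x , eq

aw∉IN-U : ∀ (x : Fin n) → aw x ∉ˡ IN-U
aw∉IN-U x p∈ with ∈IN-U⁻ p∈
... | _ , ()

in′∉IN-U : ∀ (x : Fin n) → in′ x ∉ˡ IN-U
in′∉IN-U x p∈ with ∈IN-U⁻ p∈
... | _ , ()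

r∉IN-U : ∀ (x y : Fin n) → r x y ∉ˡ IN-U
r∉IN-U x y p∈ with ∈IN-U⁻ p∈
... | _ , ()

module _ {v v′ : Valuation n} (agree : AgreeOutside IN-U v v′) where

  ⌊⌋-agree : ⌊ v′ ⌋ ≡ ⌊ v ⌋
  ⌊⌋-agree = ⌊⌋-cong {v = v′} {v} (λ x → agree (aw x) (aw∉IN-U x)) (λ x y → agree (r x y) (r∉IN-U x y))

  cps-agree : cps v′ ≡ cps v
  cps-agree = tabulate-cong λ x → agree (in′ x) (in′∉IN-U x)

  pointwise : ∀ {Q : Rel Bool 0ℓ} → Reflexive Q →
              (∀ x → Q (v (in° x)) (v′ (in° x))) → ∀ q → Q (v q) (v′ q)
  pointwise {Q} Q-refl h (in° x)   = h x
  pointwise {Q} Q-refl h (aw x)    = subst (Q _) (sym (agree (aw x) (aw∉IN-U x))) Q-refl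
  pointwise {Q} Q-refl h (in′ x)   = subst (Q _) (sym (agree (in′ x) (in′∉IN-U x))) Q-refl
  pointwise {Q} Q-refl h (r x y)   = subst (Q _) (sym (agree (r x y) (r∉IN-U x y))) Q-refl
  pointwise {Q} Q-refl h (other k) = subst (Q _) (sym (agree (other k) other∉)) Q-refl
    where
    other∉ : other k ∉ˡ IN-U
    other∉ p∈ with ∈IN-U⁻ p∈
    ... | _ , ()

-- The state at which a box is instantiated when it has to speak about a given set `E`.
setIns : Valuation n → Subset n → Valuation n
setIns v E (in° x) = lookup E x
setIns v E p       = v p

setIns-agree : ∀ (v : Valuation n) E → AgreeOutside IN-U v (setIns v E)
setIns-agree v E (aw x)    _  = refl
setIns-agree v E (in° x)   q∉ = contradiction (in°∈IN-U x) q∉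
setIns-agree v E (in′ x)   _  = refl
setIns-agree v E (r x y)   _  = refl
setIns-agree v E (other k) _  = refl

ins-setIns : ∀ (v : Valuation n) E → ins (setIns v E) ≡ E
ins-setIns v E = tabulate∘lookup E

setIns-true : ∀ (v : Valuation n) q → setIns v Subset.⊥ q ≡ true →
              v q ≡ true × (∀ x → q ≢ in° x)
setIns-true v (aw x)    eq = eq , λ _ ()
setIns-true v (in° x)   eq = contradiction (lookup⇒[]= x Subset.⊥ eq) ∉⊥
setIns-true v (in′ x)   eq = eq , λ _ ()
setIns-true v (r x y)   eq = eq , λ _ ()
setIns-true v (other k) eq = eq , λ _ ()

update-agree : ∀ (v : Valuation n) x b → AgreeOutside IN-U v (update v (in° x) b)
update-agree v x b q q∉ =
  proj₂ (update-assigns v (in° x) b) q λ { refl → q∉ (in°∈IN-U x) }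

-- Programs that enlarge or shrink the encoded set

step-one : ∀ (φ : Formula n) π {p b} → (∀ {v v′} → ∥ π ∥ v v′ iff Assigns p b v v′) →
           ∀ {v v′} → ∥ test φ ⨾ π ∥ v v′ iff (v ⊨ φ × Assigns p b v v′)
step-one φ π π-assigns {v} = mk⇔
  (λ { (u , (eq , h) , s) → h , assigns-resp (≐⇒≗ eq) (λ _ → refl) (to π-assigns s) })
  (λ (h , asg) → v , (≗⇒≐ (λ _ → refl) , h) , from π-assigns asg)

mkTrueOne-step : ∀ (p : Prp n) {v v′} →
  ∥ test (∼ var p) ⨾ + p ∥ v v′ iff (v p ≡ false × Assigns p true v v′)
mkTrueOne-step p {v} = iff-trans (step-one (∼ var p) (+ p) (plus-assigns p))
  (mk⇔ (Product.map₁ ¬-not) (Product.map₁ not-¬))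

mkFalseOne-step : ∀ (p : Prp n) {v v′} →
  ∥ test (var p) ⨾ - p ∥ v v′ iff (v p ≡ true × Assigns p false v v′)
mkFalseOne-step p = step-one (var p) (- p) (minus-assigns p)

-- One step that moves some in° x to the greatest element b of the order Q, followed by
-- arbitrary further increases along Q.
module _ .{{_ : NonZero n}} {Q : Rel Bool 0ℓ} (Q-refl : Reflexive Q) (Q-trans : Transitive Q)
         (b : Bool) (Q-top : ∀ c → Q c b) (Q-top⁻ : ∀ {c} → Q b c → c ≡ b)
         {π₁ π₂ : Prp n → Program n}
         (one : ∀ p {v v′} → ∥ π₁ p ∥ v v′ iff (v p ≡ not b × Assigns p b v v′))
         (some : ∀ {v v′} → ∥ ⨾-over IN-U π₂ ∥ v v′ iff Changes Q IN-U v v′)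
  where

  proper-change : ∀ {v v′} → ∥ ∪-over IN-U π₁ ⨾ ⨾-over IN-U π₂ ∥ v v′ iff
    (AgreeOutside IN-U v v′ × (∀ x → Q (v (in° x)) (v′ (in° x))) ×
     ∃[ x ] (v (in° x) ≡ not b × v′ (in° x) ≡ b))
  proper-change {v} {v′} = mk⇔ sound complete
    where
    sound : ∥ ∪-over IN-U π₁ ⨾ ⨾-over IN-U π₂ ∥ v v′ → _
    sound (u , s , t)
      -- Argument 0, available by `NonZero n`, shows that `IN-U` is non-empty.
      with p , p∈ , s₁ ← fold-∪⁻ π₁ {j = in° (Fin.fromℕ< (ℕₚ.n≢0⇒n>0 (≢-nonZero⁻¹ n)))} (in°∈IN-U _) s
      with x , refl ← ∈IN-U⁻ p∈ =
        (λ q q∉ → trans (proj₁ (to some t) q q∉) (off q λ { refl → q∉ (in°∈IN-U x) }))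
      , (λ y → Q-trans (v≲u (in° y)) (proj₂ (to some t) (in° y)))
      , x , proj₁ (to (one _) s₁)
      -- A variable moved to the greatest element cannot leave it by further increases.
      , Q-top⁻ (subst (λ c → Q c (v′ (in° x))) at (proj₂ (to some t) (in° x)))
      where
      at = proj₁ (proj₂ (to (one (in° x)) s₁))
      off = proj₂ (proj₂ (to (one (in° x)) s₁))
      v≲u : ∀ q → Q (v q) (u q)
      v≲u q with q ≟ in° x
      ... | yes refl = subst (Q (v q)) (sym at) (Q-top _)
      ... | no  q≢   = subst (Q (v q)) (sym (off q q≢)) Q-refl

    complete : _ → ∥ ∪-over IN-U π₁ ⨾ ⨾-over IN-U π₂ ∥ v v′
    complete (agree , rel , x , v≡ , v′≡) =
        u
      , fold-∪⁺ π₁ (in°∈IN-U x) (from (one (in° x)) (v≡ , update-assigns v (in° x) b))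
      , from some (agree′ , u≲v′)
      where
      -- Only the variable known to change strictly is moved first; all other differences between
      -- `v` and `v′` are left to the second program.
      u = update v (in° x) b
      at = proj₁ (update-assigns v (in° x) b)
      off = proj₂ (update-assigns v (in° x) b)
      agree′ : AgreeOutside IN-U u v′
      agree′ q q∉ = trans (agree q q∉) (sym (update-agree v x b q q∉))
      u≲v′ : ∀ q → Q (u q) (v′ q)
      u≲v′ q with q ≟ in° x
      ... | yes refl = subst (Q (u q)) (trans at (sym v′≡)) Q-refl
      ... | no  q≢   =
        subst (λ c → Q c (v′ q)) (sym (off q q≢)) (pointwise agree {Q} Q-refl rel q)

ins-⊆ : ∀ (v v′ : Valuation n) → (∀ x → v (in° x) ≤ v′ (in° x)) iff ins v ⊆ ins v′
ins-⊆ v v′ = mk⇔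
  (λ le {x} x∈ → ∈-tabulate⁺ (true-≤ (le x) (∈-tabulate⁻ x∈)))
  (λ sub x → ≤-true (λ eq → ∈-tabulate⁻ (sub (∈-tabulate⁺ {x = x} eq))))

∉-tabulate : ∀ {f : Fin n → Bool} {x} → f x ≡ false iff (¬ (x ∈ tabulate f))
∉-tabulate {f = f} {x} = mk⇔
  (λ eq x∈ → contradiction (trans (sym eq) (∈-tabulate⁻ x∈)) λ ())
  (λ x∉ → ¬-not (x∉ ∘ ∈-tabulate⁺))

-- Without arguments both programs would be `skip` and relate `v` to itself, whereas no set is a
-- proper subset of itself.
enlarge : .{{_ : NonZero n}} → ∀ {v v′ : Valuation n} →
  ∥ mkTrueOne IN-U ⨾ mkTrueSome IN-U ∥ v v′ iff (AgreeOutside IN-U v v′ × ins v ⊂ ins v′)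
enlarge {v = v} {v′} = iff-trans
  (proper-change {Q = _≤_} ≤-refl ≤-trans true Boolₚ.≤-maximum (λ { b≤b → refl })
    mkTrueOne-step (mkTrueSome-changes IN-U))
  (mk⇔
    (λ (agree , le , x , v≡ , v′≡) →
       agree , (λ {y} → to (ins-⊆ v v′) le {y}) , x , ∈-tabulate⁺ v′≡ , to ∉-tabulate v≡)
    (λ (agree , sub , x , x∈ , x∉) →
       agree , from (ins-⊆ v v′) sub , x , from ∉-tabulate x∉ , ∈-tabulate⁻ x∈))

shrink : .{{_ : NonZero n}} → ∀ {v v′ : Valuation n} →
  ∥ mkFalseOne IN-U ⨾ mkFalseSome IN-U ∥ v v′ iff (AgreeOutside IN-U v v′ × ins v′ ⊂ ins v)
shrink {v = v} {v′} = iff-trans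
  (proper-change {Q = flip _≤_} ≤-refl (λ c≤b d≤c → ≤-trans d≤c c≤b) false Boolₚ.≤-minimum
    (λ { b≤b → refl }) mkFalseOne-step (mkFalseSome-changes IN-U))
  (mk⇔
    (λ (agree , le , x , v≡ , v′≡) →
       agree , (λ {y} → to (ins-⊆ v′ v) le {y}) , x , ∈-tabulate⁺ v≡ , to ∉-tabulate v′≡)
    (λ (agree , sub , x , x∈ , x∉) →
       agree , from (ins-⊆ v′ v) sub , x , ∈-tabulate⁻ x∈ , from ∉-tabulate x∉))

attacked? : ∀ (F : AF n) E x → Dec (∃[ y ] (y ∈ E × Attacks F y x))
attacked? F E x = Finₚ.any? λ y → y ∈? E ×-dec x ∈? lookup (attacks F) y

⁺? : ∀ (F : AF n) E → U.Decidable (E ⁺[ F ])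
⁺? F E x = x ∈? args F ×-dec attacked? F E x

⊕? : ∀ (F : AF n) E → U.Decidable (E ⊕[ F ])
⊕? F E x = x ∈? E ⊎-dec ⁺? F E x

-- Formulas expressing properties of sets of arguments

-- A record, because `v ⊨ φ` computes: as parameters, `φ` and `Q` remain available to unification.
record Expresses (φ : Formula n) (Q : AF n → Pred (Subset n) 0ℓ) : Set where
  field
    expressed : ∀ v → v ⊨ φ iff Q ⌊ v ⌋ (ins v)

open Expresses

module _ {φ : Formula n} {Q : AF n → Pred (Subset n) 0ℓ} (expr : Expresses φ Q) where

  -- Inside a box the state varies but the framework does not, so `φ` at `v′` is read as a statement
  -- about another set in the framework of `v`.
  ⊨-agree : ∀ {v v′} → AgreeOutside IN-U v v′ → v′ ⊨ φ iff Q ⌊ v ⌋ (ins v′)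
  ⊨-agree {v′ = v′} agree =
    subst (λ F → v′ ⊨ φ iff Q F (ins v′)) (⌊⌋-agree agree) (expr .expressed v′)

  ⊨-setIns : ∀ v {E} → Q ⌊ v ⌋ E → setIns v E ⊨ φ
  ⊨-setIns v {E} q =
    from (⊨-agree (setIns-agree v E)) (subst (Q ⌊ v ⌋) (sym (ins-setIns v E)) q)

  extend-iff : ∀ {v v′} → ∥ extend φ ∥ v v′ iff (AgreeOutside IN-U v v′ × Q ⌊ v ⌋ (ins v′))
  extend-iff {v} {v′} = mk⇔
    (λ (u , s , eq , h) →
      let agree = λ q q∉ → trans (≐⇒≗ eq q) (to (vary-changes IN-U) s q q∉) in
      agree , to (⊨-agree agree) (⊨-resp φ (sym ∘ ≐⇒≗ eq) h))
    (λ (agree , q) →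
      v′ , from (vary-changes IN-U) agree , ≗⇒≐ (λ _ → refl) , from (⊨-agree agree) q)

  extend-total : ∀ v {E} → Q ⌊ v ⌋ E → ∃[ v′ ] (∥ extend φ ∥ v v′ × ins v′ ≡ E)
  extend-total v {E} q =
      setIns v E
    , from extend-iff (setIns-agree v E , subst (Q ⌊ v ⌋) (sym (ins-setIns v E)) q)
    , ins-setIns v E

  -- `Maximal` denies an existence and the box stands before a negation, so both sides are
  -- refutations and no classical step is needed.
  maximal-expresses : .{{_ : NonZero n}} →
    Expresses (φ ∧ [ mkTrueOne IN-U ⨾ mkTrueSome IN-U ] ∼ φ) (λ F → Maximal (Q F))
  maximal-expresses .expressed v = mk⇔
    (λ (h , box) → to (expr .expressed v) h , λ (E′ , q , E⊂E′) →
      box (setIns v E′)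
          (from enlarge (setIns-agree v E′ , subst (ins v ⊂_) (sym (ins-setIns v E′)) E⊂E′))
          (⊨-setIns v q))
    (λ (q , max) → from (expr .expressed v) q , λ v′ s h →
      let agree , sub = to enlarge s in max (ins v′ , to (⊨-agree agree) h , sub))

  minimal-expresses : .{{_ : NonZero n}} →
    Expresses (φ ∧ [ mkFalseOne IN-U ⨾ mkFalseSome IN-U ] ∼ φ) (λ F → Minimal (Q F))
  minimal-expresses .expressed v = mk⇔
    (λ (h , box) → to (expr .expressed v) h , λ (E′ , q , E′⊂E) →
      box (setIns v E′)
          (from shrink (setIns-agree v E′ , subst (_⊂ ins v) (sym (ins-setIns v E′)) E′⊂E))
          (⊨-setIns v q))
    (λ (q , min) → from (expr .expressed v) q , λ v′ s h →
      let agree , sub = to shrink s in min (ins v′ , to (⊨-agree agree) h , sub))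

  -- The box tries only one-element enlargements. These suffice for a property closed under subsets:
  -- a proper superset with the property contains such an enlargement, which then has it too.
  maximal-expresses-one : .{{_ : NonZero n}} → (∀ {F E E′} → E ⊆ E′ → Q F E′ → Q F E) →
    Expresses (φ ∧ [ mkTrueOne IN-U ] ∼ φ) (λ F → Maximal (Q F))
  maximal-expresses-one closed .expressed v = mk⇔ sound complete
    where
    sound : _ → Maximal (Q ⌊ v ⌋) (ins v)
    sound (h , box) = to (expr .expressed v) h , bigger
      where
      bigger : ¬ (∃[ E′ ] (Q ⌊ v ⌋ E′ × ins v ⊂ E′))
      bigger (E′ , q , sub , x , x∈ , x∉) =
        box u (fold-∪⁺ (λ p → test (∼ var p) ⨾ + p) (in°∈IN-U x)
                (from (mkTrueOne-step (in° x)) (from ∉-tabulate x∉ , asg)))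
              (from (⊨-agree (update-agree v x true)) (closed {E = ins u} u⊆E′ q))
        where
        u = update v (in° x) true
        asg = update-assigns v (in° x) true
        u⊆E′ : ins u ⊆ E′
        u⊆E′ {y} y∈ with y Finₚ.≟ x
        ... | yes refl = x∈
        ... | no  y≢x  = sub (∈-tabulate⁺
          (trans (sym (proj₂ asg (in° y) λ { refl → y≢x refl })) (∈-tabulate⁻ y∈)))

    complete : Maximal (Q ⌊ v ⌋) (ins v) → _
    complete (q , max) = from (expr .expressed v) q , λ v′ s h →
      -- A single addition is an enlargement in which `mkTrueSome` changes nothing.
      let agree , sub = to enlarge (v′ , s , from (mkTrueSome-changes IN-U {v′} {v′})
                          ((λ _ _ → refl) , λ _ → ≤-refl))
      in max (ins v′ , to (⊨-agree agree) h , sub)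

  -- The antecedent reads `in° x` before the in-variables are varied and the consequent reads it
  -- afterwards; this is how one formula compares two sets without a copy.
  ⊆-all-expresses : ∀ v → v ⊨ (⋀ λ x → var (in° x) ⇒ [ extend φ ] var (in° x)) iff
                    (∀ E′ → Q ⌊ v ⌋ E′ → ins v ⊆ E′)
  ⊆-all-expresses v = mk⇔
    (λ h E′ q {x} x∈ →
      let v′ , s , eq = extend-total v q in
      subst (x ∈_) eq (∈-tabulate⁺
        (⇒-elim v (var (in° x)) ([ extend φ ] var (in° x))
          (⋀⁻ (λ x → var (in° x) ⇒ [ extend φ ] var (in° x)) v h x) (∈-tabulate⁻ x∈) v′ s)))
    (λ h → ⋀⁺ (λ x → var (in° x) ⇒ [ extend φ ] var (in° x)) v λ x →
      ⇒-intro v (var (in° x)) ([ extend φ ] var (in° x)) λ inx v′ s →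
        ∈-tabulate⁻ (h (ins v′) (proj₂ (to extend-iff s)) (∈-tabulate⁺ inx)))

-- Copies and the comparison of ranges

-- Definitionally the local function of `copy`, named so that lemmas can refer to it.
copyOne : Fin n → Program n
copyOne x = (test (var (in° x)) ⨾ + in′ x) ∪ (test (∼ var (in° x)) ⨾ - in′ x)

copyOne-assigns : ∀ (x : Fin n) {v v′} →
                  ∥ copyOne x ∥ v v′ iff Assigns (in′ x) (v (in° x)) v v′
copyOne-assigns x {v} {v′} = mk⇔
  [ (λ s → let h , asg = to true-step s in
           subst (λ b → Assigns (in′ x) b v v′) (sym h) asg)
  , (λ s → let h , asg = to false-step s in
           subst (λ b → Assigns (in′ x) b v v′) (sym (¬-not h)) asg) ]′
  (choose (v (in° x)) refl)
  where
  true-step = step-one (var (in° x)) (+ in′ x) (plus-assigns (in′ x)) {v} {v′}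
  false-step = step-one (∼ var (in° x)) (- in′ x) (minus-assigns (in′ x)) {v} {v′}

  choose : ∀ b → v (in° x) ≡ b → Assigns (in′ x) b v v′ → ∥ copyOne x ∥ v v′
  choose true  eq asg = inj₁ (from true-step (eq , asg))
  choose false eq asg = inj₂ (from false-step (not-¬ eq , asg))

copy-total : ∀ (v : Valuation n) → ∃[ v′ ] ∥ copy ∥ v v′
copy-total {n} = fold-⨾-total copyOne
  (λ x v → update v (in′ x) (v (in° x)) ,
           from (copyOne-assigns x) (update-assigns v (in′ x) (v (in° x))))
  (allFin n)

private
  -- The second disjunct carries a copy that has been made through the remaining steps.
  Copies : List (Fin n) → Rel (Valuation n) 0ℓ
  Copies xs v v′ = (∀ q → (∀ x → q ≢ in′ x) → v′ q ≡ v q) ×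
    (∀ x → x ∈ˡ xs ⊎ v (in′ x) ≡ v (in° x) → v′ (in′ x) ≡ v (in° x))

  copies-step : ∀ x xs {v u v′ : Valuation n} →
                ∥ copyOne x ∥ v u → Copies xs u v′ → Copies (x ∷ xs) v v′
  copies-step x xs {v} {u} s (frame , cp) =
      (λ q q≢ → trans (frame q q≢) (off q (q≢ x)))
    , λ y d → trans (cp y (settled y d)) (off (in° y) λ ())
    where
    at = proj₁ (to (copyOne-assigns x) s)
    off = proj₂ (to (copyOne-assigns x) s)

    settled-x : u (in′ x) ≡ u (in° x)
    settled-x = trans at (sym (off (in° x) λ ()))

    settled : ∀ y → y ∈ˡ x ∷ xs ⊎ v (in′ y) ≡ v (in° y) → y ∈ˡ xs ⊎ u (in′ y) ≡ u (in° y)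
    settled y (inj₁ (here refl)) = inj₂ settled-x
    settled y (inj₁ (there y∈))  = inj₁ y∈
    settled y (inj₂ eq) with y Finₚ.≟ x
    ... | yes refl = inj₂ settled-x
    ... | no  y≢x  = inj₂ (trans (off (in′ y) λ { refl → y≢x refl })
                                 (trans eq (sym (off (in° y) λ ()))))

copy⁻ : ∀ {v v′ : Valuation n} → ∥ copy ∥ v v′ → ⌊ v′ ⌋ ≡ ⌊ v ⌋ × cps v′ ≡ ins v
copy⁻ {n} {v} {v′} s =
    ⌊⌋-cong {v = v′} {v} (λ x → frame (aw x) λ _ ()) (λ x y → frame (r x y) λ _ ())
  , tabulate-cong λ x → cp x (inj₁ (∈-allFin x))
  where
  copies : Copies (allFin n) v v′
  copies = fold-⨾⁻ copyOne Copies
    (λ eq → (λ q _ → sym (eq q)) ,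
            λ { x (inj₁ ()) ; x (inj₂ e) → trans (sym (eq (in′ x))) e })
    copies-step (allFin n) s
  frame = proj₁ copies
  cp = proj₂ copies

-- The family `p` is either `in°` or `in′`. The inclusion in the arguments matters because `r y x`
-- may be true for a `y` outside the framework, where it is no attack.
range-expresses : ∀ (v : Valuation n) (p : Fin n → Prp n) → tabulate (v ∘ p) ⊆ args ⌊ v ⌋ →
  ∀ x → v ⊨ var (p x) ∨ (var (aw x) ∧ ⋁ λ y → var (p y) ∧ var (r y x)) iff
        (tabulate (v ∘ p) ⊕[ ⌊ v ⌋ ]) x
range-expresses v p sub x = mk⇔
  (λ h → decidable-stable (⊕? ⌊ v ⌋ (tabulate (v ∘ p)) x) λ ¬rg →
    h ( (λ px → ¬rg (inj₁ (∈-tabulate⁺ px)))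
      , λ (awx , ors) → ⋁⁻ (λ y → var (p y) ∧ var (r y x)) v ors λ (y , py , ryx) →
          ¬rg (inj₂ (∈-tabulate⁺ awx , y , ∈-tabulate⁺ py ,
                     Attacks⁺ v (∈-tabulate⁻ (sub (∈-tabulate⁺ py))) awx ryx))))
  λ { (inj₁ x∈) (¬a , _) → ¬a (∈-tabulate⁻ x∈)
    ; (inj₂ (x∈ , y , y∈ , yRx)) (_ , ¬b) →
        ¬b (∈-tabulate⁻ x∈ , ⋁⁺ (λ y → var (p y) ∧ var (r y x)) v y
                               (∈-tabulate⁻ y∈ , Attacks⁻ v yRx)) }

inclusion-expresses : ∀ (v : Valuation n) (φ ψ : Fin n → Formula n) {P P′ : Pred (Fin n) 0ℓ} →
  (∀ x → v ⊨ φ x iff P x) → (∀ x → v ⊨ ψ x iff P′ x) →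
  v ⊨ (⋀ λ x → φ x ⇒ ψ x) iff P U.⊆ P′
inclusion-expresses v φ ψ φ-iff ψ-iff = mk⇔
  (λ h {x} p → to (ψ-iff x)
    (⇒-elim v (φ x) (ψ x) (⋀⁻ (λ x → φ x ⇒ ψ x) v h x) (from (φ-iff x) p)))
  (λ sub → ⋀⁺ (λ x → φ x ⇒ ψ x) v λ x →
    ⇒-intro v (φ x) (ψ x) λ h → from (ψ-iff x) (sub (to (φ-iff x) h)))

-- Used at the state after `copy ⨾ extend φ`: `F` and `E` are the framework and the set of the state
-- before it.
ranges-express : ∀ (v : Valuation n) {F E} → ⌊ v ⌋ ≡ F → cps v ≡ E →
  ins v ⊆ args F → E ⊆ args F →
  (v ⊨ IncludesCp iff (E ⊕[ F ]) U.⊆ (ins v ⊕[ F ])) ×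
  (v ⊨ IncludedInCp iff (ins v ⊕[ F ]) U.⊆ (E ⊕[ F ]))
ranges-express v refl refl ins⊆ cps⊆ =
    inclusion-expresses v Rg′ Rg (range-expresses v in′ cps⊆) (range-expresses v in° ins⊆)
  , inclusion-expresses v Rg Rg′ (range-expresses v in° ins⊆) (range-expresses v in′ cps⊆)

module _ {φ : Formula n} {Q : AF n → Pred (Subset n) 0ℓ} (expr : Expresses φ Q) where

  copy-extend⁻ : ∀ {v v′} → ∥ copy ⨾ extend φ ∥ v v′ →
                 ⌊ v′ ⌋ ≡ ⌊ v ⌋ × cps v′ ≡ ins v × Q ⌊ v ⌋ (ins v′)
  copy-extend⁻ {v′ = v′} (u , s , t) =
    let F≡ , cps≡ = copy⁻ s
        agree , q = to (extend-iff expr) t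
    in trans (⌊⌋-agree agree) F≡ , trans (cps-agree agree) cps≡ , subst (λ F → Q F (ins v′)) F≡ q

  copy-extend⁺ : ∀ v {E} → Q ⌊ v ⌋ E → ∃[ v′ ] (∥ copy ⨾ extend φ ∥ v v′ × ins v′ ≡ E)
  copy-extend⁺ v {E} q =
    let u , s       = copy-total v
        v′ , t , eq = extend-total expr u (subst (λ F → Q F E) (sym (proj₁ (copy⁻ s))) q)
    in v′ , (u , s , t) , eq

  -- The copy holds the original set and the in-variables a competitor. Strict inclusion of ranges
  -- is the conjunction of `IncludesCp` and `∼ IncludedInCp`, and the implication under the box
  -- abbreviates its negation.
  rangeMaximal-expresses : (∀ {F E} → Q F E → E ⊆ args F) →
    Expresses (φ ∧ [ copy ⨾ extend φ ] (IncludesCp ⇒ IncludedInCp))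
              (λ F → RangeMaximal F (Q F))
  rangeMaximal-expresses Q⊆args .expressed v = mk⇔ sound complete
    where
    sound : _ → RangeMaximal ⌊ v ⌋ (Q ⌊ v ⌋) (ins v)
    sound (h , box) = q , bigger
      where
      q = to (expr .expressed v) h

      bigger : ¬ (∃[ E′ ] (Q ⌊ v ⌋ E′ × (ins v ⊕[ ⌊ v ⌋ ]) U.⊂ (E′ ⊕[ ⌊ v ⌋ ])))
      bigger (E′ , q′ , sub , nsub)
        with v′ , s , refl ← copy-extend⁺ v q′
        with F≡ , cps≡ , _ ← copy-extend⁻ s
        with includes , included ← ranges-express v′ F≡ cps≡ (Q⊆args q′) (Q⊆args q) =
        box v′ s (from includes (λ {x} → sub {x}) , λ inc → nsub (to included inc))

    complete : RangeMaximal ⌊ v ⌋ (Q ⌊ v ⌋) (ins v) → _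
    complete (q , max) = from (expr .expressed v) q , λ v′ s (inc , ¬inc) →
      let F≡ , cps≡ , q′      = copy-extend⁻ s
          includes , included = ranges-express v′ F≡ cps≡ (Q⊆args q′) (Q⊆args q)
      in max (ins v′ , q′ , to includes inc , ¬inc ∘ from included)

-- Formulas without modalities

module _ (v : Valuation n) where

  well-expresses : v ⊨ Well iff ins v ⊆ args ⌊ v ⌋
  well-expresses = mk⇔
    (λ h {x} x∈ → ∈-tabulate⁺
      (⇒-elim v (var (in° x)) (var (aw x)) (⋀⁻ (λ x → var (in° x) ⇒ var (aw x)) v h x)
        (∈-tabulate⁻ x∈)))
    (λ sub → ⋀⁺ (λ x → var (in° x) ⇒ var (aw x)) v λ x →
      ⇒-intro v (var (in° x)) (var (aw x)) λ inx →
        ∈-tabulate⁻ (sub (∈-tabulate⁺ inx)))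

  attacked : Fin n → Formula n
  attacked x = ⋁ λ y → var (in° y) ∧ var (r y x)

  module _ (sub : ins v ⊆ args ⌊ v ⌋) {x} (awx : v (aw x) ≡ true) where

    attacked-expresses : v ⊨ attacked x iff (∃[ y ] (y ∈ ins v × Attacks ⌊ v ⌋ y x))
    attacked-expresses = mk⇔
      (λ h → decidable-stable (attacked? ⌊ v ⌋ (ins v) x)
        (¬¬-map (λ (y , iny , ryx) → y , ∈-tabulate⁺ iny ,
                   Attacks⁺ v (∈-tabulate⁻ (sub (∈-tabulate⁺ iny))) awx ryx)
                (⋁⁻ (λ y → var (in° y) ∧ var (r y x)) v h)))
      (λ (y , y∈ , yRx) →
        ⋁⁺ (λ y → var (in° y) ∧ var (r y x)) v y (∈-tabulate⁻ y∈ , Attacks⁻ v yRx))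

  module _ (sub : ins v ⊆ args ⌊ v ⌋) {x} (awx : v (aw x) ≡ true) where

    defended-expresses : v ⊨ defended x iff Defends ⌊ v ⌋ (ins v) x
    defended-expresses = mk⇔
      (λ h y y∈A yRx → y∈A , to (attacked-expresses sub (∈-tabulate⁻ y∈A))
        (⇒-elim v (var (aw y) ∧ var (r y x)) (attacked y)
          (⋀⁻ (λ y → (var (aw y) ∧ var (r y x)) ⇒ attacked y) v h y)
          (∈-tabulate⁻ y∈A , Attacks⁻ v yRx)))
      (λ d → ⋀⁺ (λ y → (var (aw y) ∧ var (r y x)) ⇒ attacked y) v λ y →
        ⇒-intro v (var (aw y) ∧ var (r y x)) (attacked y) λ (awy , ryx) →
          from (attacked-expresses sub awy)
            (proj₂ (d y (∈-tabulate⁺ awy) (Attacks⁺ v awy awx ryx))))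

conFree-expresses : Expresses {n} ConFree ConflictFree
conFree-expresses .expressed v = mk⇔
  (λ (well , cf) →
      (λ {x} → to (well-expresses v) well {x})
    , λ x (x∈ , _ , y , y∈ , yRx) →
        ⋀⁻ (λ x → ∼ (var (in° y) ∧ var (in° x) ∧ var (r y x))) v
          (⋀⁻ (λ x → ⋀ λ y → ∼ (var (in° x) ∧ var (in° y) ∧ var (r x y))) v cf y) x
          (∈-tabulate⁻ y∈ , ∈-tabulate⁻ x∈ , Attacks⁻ v yRx))
  (λ (sub , empty) →
      from (well-expresses v) sub
    , ⋀⁺ (λ x → ⋀ λ y → ∼ (var (in° x) ∧ var (in° y) ∧ var (r x y))) v λ x →
      ⋀⁺ (λ y → ∼ (var (in° x) ∧ var (in° y) ∧ var (r x y))) v λ y (inx , iny , rxy) →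
        let x∈ = ∈-tabulate⁺ inx
            y∈ = ∈-tabulate⁺ iny
        in empty y (y∈ , sub y∈ , x , x∈ ,
                    Attacks⁺ v (∈-tabulate⁻ (sub x∈)) (∈-tabulate⁻ (sub y∈)) rxy))

admissible-expresses : Expresses {n} Admissible AdmissibleSet
admissible-expresses .expressed v = mk⇔
  (λ (conFree , h) →
    let cf@(sub , _) = to (conFree-expresses .expressed v) conFree in
    cf , λ {x} x∈ → to (defended-expresses v sub (∈-tabulate⁻ (sub x∈)))
      (⇒-elim v (var (in° x)) (defended x) (⋀⁻ φ v h x) (∈-tabulate⁻ x∈)))
  (λ (cf@(sub , _) , d) →
      from (conFree-expresses .expressed v) cf
    , ⋀⁺ φ v λ x → ⇒-intro v (var (in° x)) (defended x) λ inx →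
        let x∈ = ∈-tabulate⁺ inx in
        from (defended-expresses v sub (∈-tabulate⁻ (sub x∈))) (d x∈))
  where
  φ : Fin _ → Formula _
  φ x = var (in° x) ⇒ defended x

complete-expresses : Expresses {n} Complete CompleteExt
complete-expresses .expressed v = mk⇔
  (λ (conFree , h) →
    let cf@(sub , _) = to (conFree-expresses .expressed v) conFree
        h′ = λ x awx → ⇒-elim v (var (aw x)) (var (in° x) ⇔ defended x) (⋀⁻ φ v h x) awx
    in cf
     , (λ {x} x∈ → let awx = ∈-tabulate⁻ (sub x∈) in
          sub x∈ , to (defended-expresses v sub awx)
            (⇒-elim v (var (in° x)) (defended x) (proj₁ (h′ x awx)) (∈-tabulate⁻ x∈)))
     , λ {x} (x∈A , d) → let awx = ∈-tabulate⁻ x∈A in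
          ∈-tabulate⁺ (⇒-elim v (defended x) (var (in° x)) (proj₂ (h′ x awx))
            (from (defended-expresses v sub awx) d)))
  (λ (cf@(sub , _) , E⊆ , ⊆E) →
      from (conFree-expresses .expressed v) cf
    , ⋀⁺ φ v λ x → ⇒-intro v (var (aw x)) (var (in° x) ⇔ defended x) λ awx →
        ⇒-intro v (var (in° x)) (defended x) (λ inx →
          from (defended-expresses v sub awx) (proj₂ (E⊆ (∈-tabulate⁺ inx))))
      , ⇒-intro v (defended x) (var (in° x)) (λ def →
          ∈-tabulate⁻ (⊆E (∈-tabulate⁺ awx , to (defended-expresses v sub awx) def))))
  where
  φ : Fin _ → Formula _
  φ x = var (aw x) ⇒ (var (in° x) ⇔ defended x)

-- `ConFree` is no conjunct here: one half of the equivalence keeps members from being attacked,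
-- which is conflict-freeness, and the other half makes every outsider attacked.
stable-expresses : Expresses {n} Stable StableExt
stable-expresses .expressed v = mk⇔
  (λ (well , h) →
    let sub : ins v ⊆ args ⌊ v ⌋
        sub {x} = to (well-expresses v) well {x}
        h′ = λ x awx → ⇒-elim v (var (aw x)) (var (in° x) ⇔ ∼ attacked v x) (⋀⁻ φ v h x) awx
    in ( (λ {x} → sub {x})
       , λ x (x∈ , x∈A , att) → let awx = ∈-tabulate⁻ x∈A in
           ⇒-elim v (var (in° x)) (∼ attacked v x) (proj₁ (h′ x awx)) (∈-tabulate⁻ x∈)
             (from (attacked-expresses v sub awx) att))
     , λ {x} (x∈A , x∉) → let awx = ∈-tabulate⁻ x∈A in
         x∈A , decidable-stable (attacked? ⌊ v ⌋ (ins v) x) λ ¬att →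
           x∉ (∈-tabulate⁺ (⇒-elim v (∼ attacked v x) (var (in° x)) (proj₂ (h′ x awx))
                             (¬att ∘ to (attacked-expresses v sub awx)))))
  (λ ((sub , empty) , outside) →
      from (well-expresses v) sub
    , ⋀⁺ φ v λ x → ⇒-intro v (var (aw x)) (var (in° x) ⇔ ∼ attacked v x) λ awx →
        ⇒-intro v (var (in° x)) (∼ attacked v x) (λ inx att →
          empty x (∈-tabulate⁺ inx , ∈-tabulate⁺ awx , to (attacked-expresses v sub awx) att))
      , ⇒-intro v (∼ attacked v x) (var (in° x)) (λ ¬att →
          ∈-tabulate⁻ (decidable-stable (x ∈? ins v) λ x∉ →
            ¬att (from (attacked-expresses v sub awx)
                   (proj₂ (outside (∈-tabulate⁺ awx , x∉)))))))
  where
  φ : Fin _ → Formula _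
  φ x = var (aw x) ⇒ (var (in° x) ⇔ ∼ attacked v x)

-- Admissible, complete and preferred sets

conflictFree-⊆ : ∀ {F : AF n} {E E′} → E ⊆ E′ → ConflictFree F E′ → ConflictFree F E
conflictFree-⊆ sub (E′⊆A , empty) =
    (λ x∈ → E′⊆A (sub x∈))
  , λ x (x∈ , x∈A , y , y∈ , yRx) → empty x (sub x∈ , x∈A , y , sub y∈ , yRx)

complete⇒admissible : ∀ {F : AF n} {E} → CompleteExt F E → AdmissibleSet F E
complete⇒admissible (cf , E⊆ , _) = cf , λ x∈ → proj₂ (E⊆ x∈)

defends-⊆ : ∀ {F : AF n} {E E′ x} → E ⊆ E′ → Defends F E x → Defends F E′ x
defends-⊆ sub d y y∈A yRx =
  let y∈A′ , z , z∈ , zRy = d y y∈A yRx in y∈A′ , z , sub z∈ , zRy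

-- `E` cannot attack `x`, since defending `x` would make `E` attack its own member. If `x` attacked
-- itself or a member of `E`, the defence would make `E` attack `x`.
fundamental-lemma : ∀ {F : AF n} {E x} → AdmissibleSet F E → x ∈ args F → Defends F E x →
                    AdmissibleSet F (E Subset.∪ ⁅ x ⁆)
fundamental-lemma {n} {F} {E} {x} ((E⊆A , empty) , defE) x∈A defx = (sub , conflict) , defended′
  where
  split : ∀ {y} → y ∈ E Subset.∪ ⁅ x ⁆ → y ∈ E ⊎ y ≡ x
  split y∈ = Sum.map₂ (x∈⁅y⁆⇒x≡y x) (x∈p∪q⁻ E ⁅ x ⁆ y∈)

  sub : E Subset.∪ ⁅ x ⁆ ⊆ args F
  sub y∈ with split y∈
  ... | inj₁ y∈E  = E⊆A y∈E
  ... | inj₂ refl = x∈A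

  no-attack : ∀ {y} → y ∈ E → ¬ Attacks F y x
  no-attack {y} y∈ yRx = empty y (y∈ , defx y (E⊆A y∈) yRx)

  defended′ : ∀ {y} → y ∈ E Subset.∪ ⁅ x ⁆ → Defends F (E Subset.∪ ⁅ x ⁆) y
  defended′ y∈ with split y∈
  ... | inj₁ y∈E  = defends-⊆ {F = F} (λ z∈ → x∈p∪q⁺ (inj₁ z∈)) (defE y∈E)
  ... | inj₂ refl = defends-⊆ {F = F} (λ z∈ → x∈p∪q⁺ (inj₁ z∈)) defx

  conflict : U.Empty (⟪ E Subset.∪ ⁅ x ⁆ ⟫ U.∩ ((E Subset.∪ ⁅ x ⁆) ⁺[ F ]))
  conflict z (z∈ , z∈A , y , y∈ , yRz) with split z∈ | split y∈
  ... | inj₁ z∈E  | inj₁ y∈E  = empty z (z∈E , z∈A , y , y∈E , yRz)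
  ... | inj₂ refl | inj₁ y∈E  = no-attack y∈E yRz
  ... | inj₁ z∈E  | inj₂ refl = let _ , w , w∈ , wRx = defE z∈E x x∈A yRz in no-attack w∈ wRx
  ... | inj₂ refl | inj₂ refl = let _ , w , w∈ , wRx = defx x x∈A yRz in no-attack w∈ wRx

unextendable⇒complete : ∀ {F : AF n} {E} → AdmissibleSet F E →
  ¬ (∃[ E′ ] (AdmissibleSet F E′ × E ⊂ E′)) → CompleteExt F E
unextendable⇒complete {F = F} {E} adm@(cf@(sub , _) , def) max =
    cf
  , (λ {x} x∈ → sub x∈ , def x∈)
  , λ {x} (x∈A , d) → decidable-stable (x ∈? E) λ x∉ →
      max (E Subset.∪ ⁅ x ⁆ , fundamental-lemma {F = F} adm x∈A d ,
           (λ y∈ → x∈p∪q⁺ (inj₁ y∈)) , x , x∈p∪q⁺ (inj₂ (x∈⁅x⁆ x)) , x∉)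

-- The harder direction is from right to left: only complete proper supersets are excluded by
-- assumption, and admissible ones have to be ruled out. Since a contradiction is the goal, no
-- maximal superset has to be constructed.
maximal-admissible⇔preferred : ∀ (F : AF n) {E} →
                               Maximal (AdmissibleSet F) E iff PreferredExt F E
maximal-admissible⇔preferred {n} F {E} = mk⇔
  (λ (adm , max) → unextendable⇒complete {F = F} adm max ,
     λ (E′ , co′ , E⊂E′) → max (E′ , complete⇒admissible {F = F} co′ , E⊂E′))
  (λ (co′ , max) → complete⇒admissible {F = F} co′ ,
     λ (E′ , adm , E⊂E′) → extend-to-complete max E′ adm E⊂E′ (⊃-wellFounded E′))
  where
  -- An admissible superset of E without complete superset could be enlarged forever.
  extend-to-complete : ¬ (∃[ E′ ] (CompleteExt F E′ × E ⊂ E′)) →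
    ∀ E′ → AdmissibleSet F E′ → E ⊂ E′ → ¬ Acc Subset._⊃_ E′
  extend-to-complete max E′ adm E⊂E′ (acc rec) =
    max (E′ , unextendable⇒complete {F = F} adm (λ (E″ , adm″ , E′⊂E″) →
      extend-to-complete max E″ adm″ (⊂-trans E⊂E′ E′⊂E″) (rec E′⊂E″)) , E⊂E′)

complete⊆args : ∀ {F : AF n} {E} → CompleteExt F E → E ⊆ args F
complete⊆args ((sub , _) , _) = sub

-- The formulas of the nine semantics

semiStable-expresses : Expresses {n} SemiStable SemiStableExt
semiStable-expresses = rangeMaximal-expresses complete-expresses λ {F} → complete⊆args {F = F}

module _ .{{_ : NonZero n}} where

  preferred-expresses : Expresses {n} Preferred PreferredExt
  preferred-expresses .expressed v = iff-trans (maximal-expresses admissible-expresses .expressed v)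
                                    (maximal-admissible⇔preferred ⌊ v ⌋)

  idealSet-expresses : Expresses {n} IdealSet IsIdealSet
  idealSet-expresses .expressed v = mk⇔
    (Product.map (to (admissible-expresses .expressed v)) (to (⊆-all-expresses preferred-expresses v)))
    (Product.map (from (admissible-expresses .expressed v)) (from (⊆-all-expresses preferred-expresses v)))

  eagerSet-expresses : Expresses {n} EagerSet IsEagerSet
  eagerSet-expresses .expressed v = mk⇔
    (Product.map (to (admissible-expresses .expressed v)) (to (⊆-all-expresses semiStable-expresses v)))
    (Product.map (from (admissible-expresses .expressed v)) (from (⊆-all-expresses semiStable-expresses v)))

  extension-expresses : ∀ σ → Expresses {n} (extensionFormula σ) (Extension σ)
  extension-expresses st  = stable-expresses
  extension-expresses co  = complete-expresses
  extension-expresses gr  = minimal-expresses complete-expresses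
  extension-expresses pr  = preferred-expresses
  extension-expresses se  = semiStable-expresses
  extension-expresses id  = maximal-expresses idealSet-expresses
  extension-expresses ea  = maximal-expresses eagerSet-expresses
  extension-expresses na  =
    maximal-expresses-one conFree-expresses λ {F} → conflictFree-⊆ {F = F}
  extension-expresses stg = rangeMaximal-expresses conFree-expresses proj₁

-- Decidability of extensions and completions

inclusion? : ∀ {P P′ : Pred (Fin n) 0ℓ} → U.Decidable P → U.Decidable P′ → Dec (P U.⊆ P′)
inclusion? P? P′? = map′ (λ h {x} → h x) (λ h x → h) (Finₚ.all? λ x → P? x →-dec P′? x)

allSubsets? : ∀ {P : Pred (Subset n) 0ℓ} → U.Decidable P → Dec (∀ E → P E)
allSubsets? P? = map′
  (λ ¬ex E → decidable-stable (P? E) λ ¬p → ¬ex (E , ¬p))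
  (λ all (E , ¬p) → ¬p (all E))
  (¬? (anySubset? (¬? ∘ P?)))

maximal? : ∀ {P : Pred (Subset n) 0ℓ} → U.Decidable P → U.Decidable (Maximal P)
maximal? P? E = P? E ×-dec ¬? (anySubset? λ E′ → P? E′ ×-dec E ⊂? E′)

minimal? : ∀ {P : Pred (Subset n) 0ℓ} → U.Decidable P → U.Decidable (Minimal P)
minimal? P? E = P? E ×-dec ¬? (anySubset? λ E′ → P? E′ ×-dec E′ ⊂? E)

module _ (F : AF n) where

  rangeMaximal? : ∀ {P : Pred (Subset n) 0ℓ} → U.Decidable P → U.Decidable (RangeMaximal F P)
  rangeMaximal? P? E = P? E ×-dec ¬? (anySubset? λ E′ → P? E′ ×-dec
    (inclusion? (⊕? F E) (⊕? F E′) ×-dec ¬? (inclusion? (⊕? F E′) (⊕? F E))))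

  conflictFree? : U.Decidable (ConflictFree F)
  conflictFree? E = E ⊆? args F ×-dec Finₚ.all? λ x → ¬? (x ∈? E ×-dec ⁺? F E x)

  defends? : ∀ E → U.Decidable (Defends F E)
  defends? E x = Finₚ.all? λ y →
    y ∈? args F →-dec (x ∈? lookup (attacks F) y →-dec ⁺? F E y)

  admissibleSet? : U.Decidable (AdmissibleSet F)
  admissibleSet? E = conflictFree? E ×-dec inclusion? (_∈? E) (defends? E)

  completeExt? : U.Decidable (CompleteExt F)
  completeExt? E = conflictFree? E ×-dec
    (inclusion? (_∈? E) defended? ×-dec inclusion? defended? (_∈? E))
    where
    defended? : U.Decidable (⟪ args F ⟫ U.∩ Defends F E)
    defended? x = x ∈? args F ×-dec defends? E x

  stableExt? : U.Decidable (StableExt F)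
  stableExt? E = conflictFree? E ×-dec
    inclusion? (λ x → x ∈? args F ×-dec ¬? (x ∈? E)) (⁺? F E)

  isIdealSet? : U.Decidable (IsIdealSet F)
  isIdealSet? E = admissibleSet? E ×-dec
    allSubsets? λ E′ → maximal? completeExt? E′ →-dec E ⊆? E′

  isEagerSet? : U.Decidable (IsEagerSet F)
  isEagerSet? E = admissibleSet? E ×-dec
    allSubsets? λ E′ → rangeMaximal? completeExt? E′ →-dec E ⊆? E′

  extension? : ∀ σ → U.Decidable (Extension σ F)
  extension? st  = stableExt?
  extension? co  = completeExt?
  extension? gr  = minimal? completeExt?
  extension? pr  = maximal? completeExt?
  extension? se  = rangeMaximal? completeExt?
  extension? id  = maximal? isIdealSet?
  extension? ea  = maximal? isEagerSet?
  extension? na  = maximal? conflictFree?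
  extension? stg = rangeMaximal? conflictFree?

-- Constraints and completions

module _ {P : List (Prp n)} where

  boolean-local : ∀ {φ} → BooleanOver P φ → ∀ {v w} → (∀ {p} → p ∈ˡ P → v p ≡ w p) →
                  v ⊨ φ iff w ⊨ φ
  boolean-local (var p∈) eq = mk⇔ (trans (sym (eq p∈))) (trans (eq p∈))
  boolean-local (∼ β)    eq = let ih = boolean-local β eq in mk⇔ (_∘ from ih) (_∘ to ih)
  boolean-local (β ∧ γ)  eq =
    let ih = boolean-local β eq
        ih′ = boolean-local γ eq
    in mk⇔ (Product.map (to ih) (to ih′)) (Product.map (from ih) (from ih′))

  boolean? : ∀ {φ} → BooleanOver P φ → ∀ v → Dec (v ⊨ φ)
  boolean? (var {p} _) v = v p Boolₚ.≟ true
  boolean? (∼ β)       v = ¬? (boolean? β v)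
  boolean? (β ∧ γ)     v = boolean? β v ×-dec boolean? γ v

_∈ˡ?_ : ∀ (p : Prp n) P → Dec (p ∈ˡ P)
_∈ˡ?_ = ListDec._∈?_ _≟_

agreeOutside-++ : ∀ (P P′ : List (Prp n)) {v v′} → AgreeOutside (P ++ P′) v v′ iff
                  (∃[ u ] (AgreeOutside P v u × AgreeOutside P′ u v′))
agreeOutside-++ {n} P P′ {v} {v′} = mk⇔
  (λ agree → u , outside , inside agree)
  (λ (w , agree , agree′) q q∉ →
    trans (agree′ q (q∉ ∘ ∈-++⁺ʳ P)) (agree q (q∉ ∘ ∈-++⁺ˡ)))
  where
  u : Valuation n
  -- Everything in `P` gets its final value in the first stage, so variables listed in both parts
  -- cause no conflict.
  u q = Bool.if does (q ∈ˡ? P) then v′ q else v q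

  outside : AgreeOutside P v u
  outside q q∉ = cong (Bool.if_then v′ q else v q) (dec-false (q ∈ˡ? P) q∉)

  inside : AgreeOutside (P ++ P′) v v′ → AgreeOutside P′ u v′
  inside agree q q∉ with q ∈ˡ? P
  ... | yes q∈  = refl
  ... | no  q∉P = agree q λ q∈ → [ q∉P , q∉ ]′ (∈-++⁻ P q∈)

-- Only the finitely many variables of `P` are free, so branching on their values is exhaustive.
-- Invariance of `D` is used at the leaves, where a candidate agrees with `v` merely pointwise.
anyAgreeing? : ∀ {D : Pred (Valuation n) 0ℓ} → U.Decidable D → (∀ {v w} → v ≗ w → D v → D w) →
               ∀ P v → Dec (∃[ v′ ] (AgreeOutside P v v′ × D v′))
anyAgreeing? D? resp [] v = map′
  (λ d → v , (λ _ _ → refl) , d)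
  (λ (v′ , agree , d) → resp (λ q → agree q λ ()) d)
  (D? v)
anyAgreeing? {D = D} D? resp (p ∷ P) v = map′
  [ weaken true , weaken false ]′
  (λ (v′ , agree , d) → split (v′ p) refl agree d)
  (anyAgreeing? D? resp P (update v p true) ⊎-dec anyAgreeing? D? resp P (update v p false))
  where
  Found : List (Prp _) → Valuation _ → Set
  Found P v = ∃[ v′ ] (AgreeOutside P v v′ × D v′)

  weaken : ∀ b → Found P (update v p b) → Found (p ∷ P) v
  weaken b (v′ , agree , d) =
    v′ , (λ q q∉ → trans (agree q (q∉ ∘ there)) (proj₂ (update-assigns v p b) q (q∉ ∘ here))) , d

  agree-update : ∀ {b v′} → v′ p ≡ b → AgreeOutside (p ∷ P) v v′ →
                 AgreeOutside P (update v p b) v′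
  agree-update {b} at agree q q∉ with q ≟ p
  ... | yes refl = trans at (sym (proj₁ (update-assigns v p b)))
  ... | no  q≢p  = trans (agree q λ { (here q≡p) → q≢p q≡p ; (there q∈) → q∉ q∈ })
                         (sym (proj₂ (update-assigns v p b) q q≢p))

  split : ∀ b {v′} → v′ p ≡ b → AgreeOutside (p ∷ P) v v′ → D v′ →
          Found P (update v p true) ⊎ Found P (update v p false)
  split true  at agree d = inj₁ (_ , agree-update at agree , d)
  split false at agree d = inj₂ (_ , agree-update at agree , d)

module _ (c : CIAF n) where

  private
    A = arguments c
    P = AW A ++ ATT² A

  makeComp-iff : ∀ {v} → ∥ makeComp c ∥ ∅ᵛ v iff (AgreeOutside P ∅ᵛ v × v ⊨ constraint c)
  makeComp-iff {v} = mk⇔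
    (λ (u , s , w , t , eq , h) →
        (λ q q∉ → trans (≐⇒≗ eq q) (from (agreeOutside-++ (AW A) (ATT² A))
          (u , to (vary-changes (AW A)) s , to (vary-changes (ATT² A)) t) q q∉))
      , ⊨-resp (constraint c) (sym ∘ ≐⇒≗ eq) h)
    (λ (agree , h) →
      let u , agree₁ , agree₂ = to (agreeOutside-++ (AW A) (ATT² A)) agree in
      u , from (vary-changes (AW A)) agree₁ ,
      v , from (vary-changes (ATT² A)) agree₂ , ≗⇒≐ (λ _ → refl) , h)

  ∈P⇒∉IN-U : ∀ {p} → p ∈ˡ P → p ∉ˡ IN-U
  ∈P⇒∉IN-U p∈ with ∈-++⁻ (AW A) p∈
  ... | inj₁ p∈AW  with x , _ , refl ← ∈-map⁻ aw p∈AW = aw∉IN-U x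
  ... | inj₂ p∈ATT with x , y , _ , _ , refl ← ∈-cartesianProductWith⁻ r (elements A) (elements A) p∈ATT
    = r∉IN-U x y

  -- A completion may be given by a valuation with some in° x true, which makeComp never
  -- reaches; these variables are reset.
  completion-iff : ∀ {F} → Completion c F iff (∃[ v ] (∥ makeComp c ∥ ∅ᵛ v × F ≡ ⌊ v ⌋))
  completion-iff = mk⇔ sound complete
    where
    sound : Completion c _ → _
    sound (v , sub , h , refl) =
      w , from makeComp-iff (agree , to (boolean-local (boolean c) same) h) ,
      sym (⌊⌋-agree (setIns-agree v Subset.⊥))
      where
      w = setIns v Subset.⊥

      same : ∀ {p} → p ∈ˡ P → v p ≡ w p
      same {p} p∈ = sym (setIns-agree v Subset.⊥ p (∈P⇒∉IN-U p∈))

      agree : AgreeOutside P ∅ᵛ w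
      agree q q∉ = ¬-not λ eq →
        -- A variable still true after the reset is true in `v`, hence lies in `Prp[ A ]`, and it is
        -- no in-variable, hence lies in `P`.
        let eq′ , not-in = setIns-true v q eq in
        [ q∉ ∘ ∈-++⁺ˡ
        , (λ q∈ → [ (λ q∈IN → let x , _ , eq = ∈-map⁻ in° q∈IN in not-in x eq)
                  , q∉ ∘ ∈-++⁺ʳ (AW A) ]′ (∈-++⁻ (IN A) q∈)) ]′
        (∈-++⁻ (AW A) (sub eq′))

    complete : _ → Completion c _
    complete (v , s , refl) = v , sub , proj₂ (to makeComp-iff s) , refl
      where
      sub : ⟦ v ⟧ᵛ U.⊆ (_∈ˡ Prp[ A ])
      sub {q} eq with q ∈ˡ? P
      ... | no  q∉ = contradiction (trans (sym eq) (proj₁ (to makeComp-iff s) q q∉)) λ ()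
      ... | yes q∈ = [ ∈-++⁺ˡ , ∈-++⁺ʳ (AW A) ∘ ∈-++⁺ʳ (IN A) ]′ (∈-++⁻ (AW A) q∈)

  -- The search runs over the valuations reached by `makeComp`, which by `completion-iff` yield
  -- every completion.
  anyCompletion? : ∀ {D : Pred (AF n) 0ℓ} → U.Decidable D → Dec (∃[ F ] (Completion c F × D F))
  anyCompletion? {D} D? = map′
    (λ (v , agree , h , d) →
      ⌊ v ⌋ , from completion-iff (v , from makeComp-iff (agree , h) , refl) , d)
    (λ { (F , comp , d) → let v , s , eq = to completion-iff comp
                              agree , h = to makeComp-iff s
                          in v , agree , h , subst D eq d })
    (anyAgreeing? (λ v → boolean? (boolean c) v ×-dec D? ⌊ v ⌋)
      (λ {v} {w} v≗w → Product.map (⊨-resp (constraint c) v≗w)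
        (subst D (⌊⌋-cong {v = v} {w} (λ x → v≗w (aw x)) (λ x y → v≗w (r x y)))))
      P ∅ᵛ)

-- The four acceptance problems

proposition7 : ∀ (n : ℕ) .{{_ : NonZero n}} (c : CIAF n) (a : Fin n) → a ∈ arguments c →
    ⊨ (constraint c ⇒ var (aw a)) → (σ : Semantics) →
    (NSA σ c a iff (v-cIAF c ⊨ [ makeComp c ⨾ makeExt σ ] var (in° a))) ×
    (NCA σ c a iff (v-cIAF c ⊨ [ makeComp c ] ⟨ makeExt σ ⟩ var (in° a))) ×
    (PCA σ c a iff (v-cIAF c ⊨ ⟨ makeComp c ⨾ makeExt σ ⟩ var (in° a))) ×
    (PSA σ c a iff (v-cIAF c ⊨ ⟨ makeComp c ⟩ [ makeExt σ ] var (in° a)))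
proposition7 n c a _ _ σ =
    mk⇔ (λ h v′ (v , s , t) → ∈-tabulate⁻ (h ⌊ v ⌋ (reached s) (ins v′) (sound t)))
        (λ h F comp E q → nsa h comp q)
  , mk⇔ (λ h v s → accepted v (h ⌊ v ⌋ (reached s)))
        (λ h F comp → nca h comp)
  , mk⇔ (λ (F , comp , ex) → pca comp ex)
        -- The diamond only refutes the absence of a completion with a suitable extension, so the
        -- pair is searched for as a whole.
        (λ h → decidable-stable (anyCompletion? c credulous?) λ ¬ex →
          h λ v′ (v , s , t) ina →
            ¬ex (⌊ v ⌋ , reached s , ins v′ , sound t , ∈-tabulate⁺ ina))
  , mk⇔ (λ (F , comp , h) → psa comp h)
        (λ h → decidable-stable (anyCompletion? c sceptical?) λ ¬ex →
          h λ v s box → ¬ex (⌊ v ⌋ , reached s , sceptical v box))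
  where
  sound : ∀ {v v′} → ∥ makeExt σ ∥ v v′ → Extension σ ⌊ v ⌋ (ins v′)
  sound t = proj₂ (to (extend-iff (extension-expresses σ)) t)

  reached : ∀ {v} → ∥ makeComp c ∥ ∅ᵛ v → Completion c ⌊ v ⌋
  reached {v} s = from (completion-iff c) (v , s , refl)

  accepted : ∀ v → ∃[ E ] (Extension σ ⌊ v ⌋ E × a ∈ E) → v ⊨ ⟨ makeExt σ ⟩ var (in° a)
  accepted v (E , q , a∈) k with v′ , t , refl ← extend-total (extension-expresses σ) v {E} q =
    k v′ t (∈-tabulate⁻ a∈)

  sceptical : ∀ v → v ⊨ [ makeExt σ ] var (in° a) → ∀ E → Extension σ ⌊ v ⌋ E → a ∈ E
  sceptical v box E q with v′ , t , refl ← extend-total (extension-expresses σ) v {E} q =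
    ∈-tabulate⁺ (box v′ t)

  credulous? : ∀ F → Dec (∃[ E ] (Extension σ F E × a ∈ E))
  credulous? F = anySubset? λ E → extension? F σ E ×-dec a ∈? E

  sceptical? : ∀ F → Dec (∀ E → Extension σ F E → a ∈ E)
  sceptical? F = allSubsets? λ E → extension? F σ E →-dec a ∈? E

  nsa : v-cIAF c ⊨ [ makeComp c ⨾ makeExt σ ] var (in° a) →
        ∀ {F E} → Completion c F → Extension σ F E → a ∈ E
  nsa h comp q with v , s , refl ← to (completion-iff c) comp =
    sceptical v (λ v′ t → h v′ (v , s , t)) _ q

  nca : v-cIAF c ⊨ [ makeComp c ] ⟨ makeExt σ ⟩ var (in° a) →
        ∀ {F} → Completion c F → ∃[ E ] (Extension σ F E × a ∈ E)
  nca h {F} comp with v , s , refl ← to (completion-iff c) comp =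
    -- The outer box fixes the completion, and only the extension remains to be found.
    decidable-stable (credulous? ⌊ v ⌋) λ ¬ex →
      h v s λ v′ t ina → ¬ex (ins v′ , sound t , ∈-tabulate⁺ ina)

  pca : ∀ {F} → Completion c F → ∃[ E ] (Extension σ F E × a ∈ E) →
        v-cIAF c ⊨ ⟨ makeComp c ⨾ makeExt σ ⟩ var (in° a)
  pca comp ex k with v , s , refl ← to (completion-iff c) comp =
    accepted v ex λ v′ t → k v′ (v , s , t)

  psa : ∀ {F} → Completion c F → (∀ E → Extension σ F E → a ∈ E) →
        v-cIAF c ⊨ ⟨ makeComp c ⟩ [ makeExt σ ] var (in° a)
  psa comp h k with v , s , refl ← to (completion-iff c) comp =
    k v s λ v′ t → ∈-tabulate⁻ (h (ins v′) (sound t))
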